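{- Let $d\ge 1$ and let $\mathbf{s}=(s_1,\ldots,s_d)$ be a strictly increasing sequence of positive integers. Then $\mathbf{P}_d^{(\mathbf{s})}$ is translation equivalent to a Fano polytope if and only if $s_1=2$ and $s_{i+1}\le 2s_i$ for all $1\le i\le d-1$. Moreover, if $\mathbf{P}_d^{(\mathbf{s})}$ is translation equivalent to a Fano polytope, then the unique interior lattice point of $\mathbf{P}_d^{(\mathbf{s})}$ is $(x_d,x_{d-1},\ldots,x_1)^T=(s_d-1,s_{d-1}-1,\ldots,s_2-1,s_1-1)^T$.
   Context: For a sequence of positive integers $\mathbf{s}=(s_1,\ldots,s_d)$, the $\mathbf{s}$-lecture hall polytope is $\mathbf{P}_d^{(\mathbf{s})}=\{\mathbf{x}\in\mathbb{R}^d : 0\le \frac{x_1}{s_1}\le\frac{x_2}{s_2}\le\cdots\le\frac{x_d}{s_d}\le 1\}$, a $d$-dimensional lattice polytope. Points are written as column vectors with $x_d$ as first entry and $x_1$ as last entry. A $d$-dimensional lattice polytope $\mathcal{P}\subset\mathbb{R}^d$ is Fano if $(\mathcal{P}\setminus\partial\mathcal{P})\cap\mathbb{Z}^d=\{\mathbf{0}\}$. Two lattice polytopes are translation equivalent if one is the translate of the other by a vector in $\mathbb{Z}^d$. -}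

module Defs where

open import Data.Nat.Base as ℕ using (ℕ; suc; NonZero)
import Data.Nat.Properties as ℕ
open import Data.Integer.Base as ℤ using (ℤ; +_)
open import Data.Rational.Base as ℚ using (ℚ; 0ℚ; 1ℚ; ½; _/_; ∣_∣; 1/_)
import Data.Rational.Properties as ℚ
open import Data.Rational.Solver using (module +-*-Solver)
open import Data.Fin.Base using (Fin; inject₁; fromℕ) renaming (zero to fzero; suc to fsuc)
open import Data.Vec.Functional using (Vector; foldr)
open import Data.Product.Base using (∃; ∃-syntax; Σ-syntax; _×_; _,_; proj₁; proj₂)
open import Function.Bundles using (_⇔_)
open import Level using (0ℓ)
open import Relation.Binary.PropositionalEquality
  using (_≡_; refl; sym; trans; cong; cong₂; subst; _≗_)
open import Relation.Unary using (Pred; _∈_; _≐_)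

open +-*-Solver using (solve; _:+_; _:*_; _:-_; :-_; _:=_)

infix  4 _≈ℝ_ _≤ℝ_ _<ℝ_ _≈ᵥ_
infixl 6 _+ℝ_ _-ℝ_ _+ᵥ_
infixl 7 _*ℝ_ _÷ℕ_
infix  8 -ℝ_

-- Real numbers: Cauchy sequences of rationals.  Equality of reals is the
-- relation _≈ℝ_ (the difference is a null sequence), not _≡_.

IsCauchy : (ℕ → ℚ) → Set
IsCauchy a = ∀ ε → 0ℚ ℚ.< ε →
  ∃[ N ] (∀ m n → N ℕ.≤ m → N ℕ.≤ n → ∣ a m ℚ.- a n ∣ ℚ.< ε)

record ℝ : Set where
  constructor mkℝ
  field
    seq    : ℕ → ℚ
    cauchy : IsCauchy seq

open ℝ public

_≈ℝ_ : ℝ → ℝ → Set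
x ≈ℝ y = ∀ ε → 0ℚ ℚ.< ε → ∃[ N ] (∀ n → N ℕ.≤ n → ∣ seq x n ℚ.- seq y n ∣ ℚ.< ε)

_≤ℝ_ : ℝ → ℝ → Set
x ≤ℝ y = ∀ ε → 0ℚ ℚ.< ε → ∃[ N ] (∀ n → N ℕ.≤ n → seq x n ℚ.≤ seq y n ℚ.+ ε)

_<ℝ_ : ℝ → ℝ → Set
x <ℝ y = ∃[ ε ] (0ℚ ℚ.< ε × ∃[ N ] (∀ n → N ℕ.≤ n → seq x n ℚ.+ ε ℚ.≤ seq y n))

private
  -- Kept abstract: unfolding these proofs when reals are normalised is costly.
  abstract
    interchange : ∀ x y z w → (x ℚ.+ y) ℚ.- (z ℚ.+ w) ≡ (x ℚ.- z) ℚ.+ (y ℚ.- w)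
    interchange = solve 4 (λ x y z w → (x :+ y) :- (z :+ w) := (x :- z) :+ (y :- w)) refl

    neg-sub : ∀ x y → ℚ.- (x ℚ.- y) ≡ (ℚ.- x) ℚ.- (ℚ.- y)
    neg-sub = solve 2 (λ x y → :- (x :- y) := (:- x) :- (:- y)) refl

    sub-add : ∀ x y → x ≡ (x ℚ.- y) ℚ.+ y
    sub-add = solve 2 (λ x y → x := (x :- y) :+ y) refl

    factor : ∀ x y z w → x ℚ.* (z ℚ.* w) ℚ.+ (z ℚ.* w) ℚ.* y ≡ ((x ℚ.+ y) ℚ.* z) ℚ.* w
    factor = solve 4 (λ x y z w → x :* (z :* w) :+ (z :* w) :* y := ((x :+ y) :* z) :* w) refl

    product-sub : ∀ x y z w → x ℚ.* y ℚ.- z ℚ.* w ≡ x ℚ.* (y ℚ.- w) ℚ.+ (x ℚ.- z) ℚ.* w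
    product-sub = solve 4 (λ x y z w → x :* y :- z :* w := x :* (y :- w) :+ (x :- z) :* w) refl

    0<½* : ∀ {ε} → 0ℚ ℚ.< ε → 0ℚ ℚ.< ½ ℚ.* ε
    0<½* {ε} 0<ε = subst (ℚ._< ½ ℚ.* ε) (ℚ.*-zeroʳ ½) (ℚ.*-monoʳ-<-pos ½ 0<ε)

    ½+½ : ∀ ε → ½ ℚ.* ε ℚ.+ ½ ℚ.* ε ≡ ε
    ½+½ ε = trans (sym (ℚ.*-distribʳ-+ ε ½ ½)) (ℚ.*-identityˡ ε)

    const-cauchy : ∀ q → IsCauchy (λ _ → q)
    const-cauchy q ε 0<ε =
      0 , λ _ _ _ _ → subst (ℚ._< ε) (sym (cong ∣_∣ (ℚ.+-inverseʳ q))) 0<ε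

    +-cauchy : ∀ {a b} → IsCauchy a → IsCauchy b → IsCauchy (λ n → a n ℚ.+ b n)
    +-cauchy {a} {b} ca cb ε 0<ε with ca (½ ℚ.* ε) (0<½* 0<ε) | cb (½ ℚ.* ε) (0<½* 0<ε)
    ... | M , p | N , q = M ℕ.⊔ N , λ m n hm hn → begin-strict
      ∣ (a m ℚ.+ b m) ℚ.- (a n ℚ.+ b n) ∣
        ≡⟨ cong ∣_∣ (interchange (a m) (b m) (a n) (b n)) ⟩
      ∣ (a m ℚ.- a n) ℚ.+ (b m ℚ.- b n) ∣
        ≤⟨ ℚ.∣p+q∣≤∣p∣+∣q∣ (a m ℚ.- a n) (b m ℚ.- b n) ⟩
      ∣ a m ℚ.- a n ∣ ℚ.+ ∣ b m ℚ.- b n ∣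
        <⟨ ℚ.+-mono-< (p m n (ℕ.m⊔n≤o⇒m≤o M N hm) (ℕ.m⊔n≤o⇒m≤o M N hn))
                      (q m n (ℕ.m⊔n≤o⇒n≤o M N hm) (ℕ.m⊔n≤o⇒n≤o M N hn)) ⟩
      ½ ℚ.* ε ℚ.+ ½ ℚ.* ε
        ≡⟨ ½+½ ε ⟩
      ε ∎
      where open ℚ.≤-Reasoning

    neg-cauchy : ∀ {a} → IsCauchy a → IsCauchy (λ n → ℚ.- a n)
    neg-cauchy {a} ca ε 0<ε with ca ε 0<ε
    ... | N , p = N , λ m n hm hn → subst (ℚ._< ε) (eq m n) (p m n hm hn)
      where
      eq : ∀ m n → ∣ a m ℚ.- a n ∣ ≡ ∣ (ℚ.- a m) ℚ.- (ℚ.- a n) ∣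
      eq m n = trans (sym (ℚ.∣-p∣≡∣p∣ (a m ℚ.- a n)))
        (cong ∣_∣ (neg-sub (a m) (a n)))

    cauchy-bounded : ∀ {a} → IsCauchy a →
      ∃[ B ] (ℚ.Positive B × ∃[ N ] (∀ n → N ℕ.≤ n → ∣ a n ∣ ℚ.≤ B))
    cauchy-bounded {a} ca with ca 1ℚ (ℚ.positive⁻¹ 1ℚ)
    ... | N , p = 1ℚ ℚ.+ ∣ a N ∣
                , ℚ.pos+nonNeg⇒pos 1ℚ ∣ a N ∣ {{ℚ.∣-∣-nonNeg (a N)}}
                , N , bound
      where
      open ℚ.≤-Reasoning
      bound : ∀ n → N ℕ.≤ n → ∣ a n ∣ ℚ.≤ 1ℚ ℚ.+ ∣ a N ∣
      bound n hn = begin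
        ∣ a n ∣
          ≡⟨ cong ∣_∣ (sub-add (a n) (a N)) ⟩
        ∣ (a n ℚ.- a N) ℚ.+ a N ∣
          ≤⟨ ℚ.∣p+q∣≤∣p∣+∣q∣ (a n ℚ.- a N) (a N) ⟩
        ∣ a n ℚ.- a N ∣ ℚ.+ ∣ a N ∣
          ≤⟨ ℚ.+-monoˡ-≤ ∣ a N ∣ (ℚ.<⇒≤ (p n N hn ℕ.≤-refl)) ⟩
        1ℚ ℚ.+ ∣ a N ∣ ∎

    product-bound : ∀ {A B δ} x y z w → .{{ℚ.Positive A}} → .{{ℚ.Positive B}} →
      ∣ x ∣ ℚ.≤ A → ∣ w ∣ ℚ.≤ B → ∣ x ℚ.- z ∣ ℚ.< δ → ∣ y ℚ.- w ∣ ℚ.< δ →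
      ∣ x ℚ.* y ℚ.- z ℚ.* w ∣ ℚ.< A ℚ.* δ ℚ.+ δ ℚ.* B
    product-bound {A} {B} {δ} x y z w x≤A w≤B xz yw = begin-strict
      ∣ x ℚ.* y ℚ.- z ℚ.* w ∣
        ≡⟨ cong ∣_∣ (product-sub x y z w) ⟩
      ∣ x ℚ.* (y ℚ.- w) ℚ.+ (x ℚ.- z) ℚ.* w ∣
        ≤⟨ ℚ.∣p+q∣≤∣p∣+∣q∣ (x ℚ.* (y ℚ.- w)) ((x ℚ.- z) ℚ.* w) ⟩
      ∣ x ℚ.* (y ℚ.- w) ∣ ℚ.+ ∣ (x ℚ.- z) ℚ.* w ∣
        ≡⟨ cong₂ ℚ._+_ (ℚ.∣p*q∣≡∣p∣*∣q∣ x (y ℚ.- w)) (ℚ.∣p*q∣≡∣p∣*∣q∣ (x ℚ.- z) w) ⟩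
      ∣ x ∣ ℚ.* ∣ y ℚ.- w ∣ ℚ.+ ∣ x ℚ.- z ∣ ℚ.* ∣ w ∣
        ≤⟨ ℚ.+-mono-≤
             (ℚ.*-monoʳ-≤-nonNeg ∣ y ℚ.- w ∣ {{ℚ.∣-∣-nonNeg (y ℚ.- w)}} x≤A)
             (ℚ.*-monoˡ-≤-nonNeg ∣ x ℚ.- z ∣ {{ℚ.∣-∣-nonNeg (x ℚ.- z)}} w≤B) ⟩
      A ℚ.* ∣ y ℚ.- w ∣ ℚ.+ ∣ x ℚ.- z ∣ ℚ.* B
        <⟨ ℚ.+-mono-< (ℚ.*-monoʳ-<-pos A yw) (ℚ.*-monoˡ-<-pos B xz) ⟩
      A ℚ.* δ ℚ.+ δ ℚ.* B ∎
      where open ℚ.≤-Reasoning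

    split-ε : ∀ A B → .{{ℚ.Positive A}} → .{{ℚ.Positive B}} → ∀ ε → 0ℚ ℚ.< ε →
      ∃[ δ ] (0ℚ ℚ.< δ × A ℚ.* δ ℚ.+ δ ℚ.* B ≡ ε)
    split-ε A B ε 0<ε = rescale (A ℚ.+ B) {{ℚ.pos+pos⇒pos A B}} refl
      where
      rescale : ∀ S → .{{ℚ.Positive S}} → S ≡ A ℚ.+ B →
        ∃[ δ ] (0ℚ ℚ.< δ × A ℚ.* δ ℚ.+ δ ℚ.* B ≡ ε)
      rescale S {{S⁺}} S≡ = i ℚ.* ε
        , subst (ℚ._< i ℚ.* ε) (ℚ.*-zeroʳ i) (ℚ.*-monoʳ-<-pos i {{ℚ.1/pos⇒pos S}} 0<ε)
        , trans (factor A B i ε)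
            (trans (cong (λ t → t ℚ.* i ℚ.* ε) (sym S≡))
              (trans (cong (ℚ._* ε) (ℚ.*-inverseʳ S {{ℚ.pos⇒nonZero S}})) (ℚ.*-identityˡ ε)))
        where
        i : ℚ
        i = (1/ S) {{ℚ.pos⇒nonZero S}}

    *-cauchy : ∀ {a b} → IsCauchy a → IsCauchy b → IsCauchy (λ n → a n ℚ.* b n)
    *-cauchy {a} {b} ca cb ε 0<ε =
      combine (cauchy-bounded ca) (cauchy-bounded cb)
      where
      Goal : Set
      Goal = ∃[ N ] (∀ m n → N ℕ.≤ m → N ℕ.≤ n → ∣ a m ℚ.* b m ℚ.- a n ℚ.* b n ∣ ℚ.< ε)

      combine :
        ∃[ A ] (ℚ.Positive A × ∃[ K ] (∀ n → K ℕ.≤ n → ∣ a n ∣ ℚ.≤ A)) →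
        ∃[ B ] (ℚ.Positive B × ∃[ L ] (∀ n → L ℕ.≤ n → ∣ b n ∣ ℚ.≤ B)) → Goal
      combine (A , A⁺ , K , boundA) (B , B⁺ , L , boundB) =
        choose (split-ε A B {{A⁺}} {{B⁺}} ε 0<ε)
        where
        choose : ∃[ δ ] (0ℚ ℚ.< δ × A ℚ.* δ ℚ.+ δ ℚ.* B ≡ ε) → Goal
        choose (δ , 0<δ , Aδ+δB≡ε) = N , bound
          where
          Na Nb N : ℕ
          Na = proj₁ (ca δ 0<δ)
          Nb = proj₁ (cb δ 0<δ)
          N = (K ℕ.⊔ L) ℕ.⊔ (Na ℕ.⊔ Nb)
          K≤ : ∀ {n} → N ℕ.≤ n → K ℕ.≤ n
          K≤ h = ℕ.m⊔n≤o⇒m≤o K L (ℕ.m⊔n≤o⇒m≤o (K ℕ.⊔ L) (Na ℕ.⊔ Nb) h)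
          L≤ : ∀ {n} → N ℕ.≤ n → L ℕ.≤ n
          L≤ h = ℕ.m⊔n≤o⇒n≤o K L (ℕ.m⊔n≤o⇒m≤o (K ℕ.⊔ L) (Na ℕ.⊔ Nb) h)
          Na≤ : ∀ {n} → N ℕ.≤ n → Na ℕ.≤ n
          Na≤ h = ℕ.m⊔n≤o⇒m≤o Na Nb (ℕ.m⊔n≤o⇒n≤o (K ℕ.⊔ L) (Na ℕ.⊔ Nb) h)
          Nb≤ : ∀ {n} → N ℕ.≤ n → Nb ℕ.≤ n
          Nb≤ h = ℕ.m⊔n≤o⇒n≤o Na Nb (ℕ.m⊔n≤o⇒n≤o (K ℕ.⊔ L) (Na ℕ.⊔ Nb) h)
          bound : ∀ m n → N ℕ.≤ m → N ℕ.≤ n → ∣ a m ℚ.* b m ℚ.- a n ℚ.* b n ∣ ℚ.< ε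
          bound m n hm hn = ℚ.<-≤-trans
            (product-bound {A} {B} {δ} (a m) (b m) (a n) (b n) {{A⁺}} {{B⁺}}
              (boundA m (K≤ hm)) (boundB n (L≤ hn))
              (proj₂ (ca δ 0<δ) m n (Na≤ hm) (Na≤ hn))
              (proj₂ (cb δ 0<δ) m n (Nb≤ hm) (Nb≤ hn)))
            (ℚ.≤-reflexive Aδ+δB≡ε)

fromℚ : ℚ → ℝ
fromℚ q = mkℝ (λ _ → q) (const-cauchy q)

fromℤ : ℤ → ℝ
fromℤ z = fromℚ (z / 1)

0ℝ 1ℝ : ℝ
0ℝ = fromℚ 0ℚ
1ℝ = fromℚ 1ℚ

_+ℝ_ : ℝ → ℝ → ℝ
x +ℝ y = mkℝ (λ n → seq x n ℚ.+ seq y n) (+-cauchy {seq x} {seq y} (cauchy x) (cauchy y))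

-ℝ_ : ℝ → ℝ
-ℝ x = mkℝ (λ n → ℚ.- seq x n) (neg-cauchy {seq x} (cauchy x))

_-ℝ_ : ℝ → ℝ → ℝ
x -ℝ y = x +ℝ (-ℝ y)

_*ℝ_ : ℝ → ℝ → ℝ
x *ℝ y = mkℝ (λ n → seq x n ℚ.* seq y n) (*-cauchy {seq x} {seq y} (cauchy x) (cauchy y))

_÷ℕ_ : ℝ → (n : ℕ) → .{{NonZero n}} → ℝ
x ÷ℕ n = x *ℝ fromℚ (+ 1 / n)

∑ : ∀ {k} → Vector ℝ k → ℝ
∑ = foldr _+ℝ_ 0ℝ

_≈ᵥ_ : ∀ {d} → Vector ℝ d → Vector ℝ d → Set
x ≈ᵥ y = ∀ i → x i ≈ℝ y i

_+ᵥ_ : ∀ {d} → Vector ℝ d → Vector ℝ d → Vector ℝ d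
(x +ᵥ y) i = x i +ℝ y i

0ᵥ : ∀ {d} → Vector ℝ d
0ᵥ _ = 0ℝ

linComb : ∀ {d k} → Vector ℝ k → Vector (Vector ℝ d) k → Vector ℝ d
linComb c v i = ∑ (λ j → c j *ℝ v j i)

lattice : ∀ {d} → Vector ℤ d → Vector ℝ d
lattice z i = fromℤ (z i)

Subset : ℕ → Set₁
Subset d = Pred (Vector ℝ d) 0ℓ

-- The topological interior; neighbourhoods are open cubes, i.e. balls of
-- the sup norm, which induces the usual topology.  Classically this is P ∖ ∂P.
interior : ∀ {d} → Subset d → Subset d
interior P x = ∃[ ε ] (0ℝ <ℝ ε ×
  (∀ y → (∀ i → (x i -ℝ ε) <ℝ y i × y i <ℝ (x i +ℝ ε)) → y ∈ P))

convexHull : ∀ {d k} → Vector (Vector ℝ d) k → Subset d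
convexHull v x = ∃[ c ] ((∀ j → 0ℝ ≤ℝ c j) × ∑ c ≈ℝ 1ℝ × x ≈ᵥ linComb c v)

AffinelyIndependent : ∀ {d k} → Vector (Vector ℝ d) k → Set
AffinelyIndependent v = ∀ c → ∑ c ≈ℝ 0ℝ → linComb c v ≈ᵥ 0ᵥ → ∀ j → c j ≈ℝ 0ℝ

IsLatticePolytope : ∀ {d} → Subset d → Set
IsLatticePolytope {d} P =
  ∃[ k ] Σ[ v ∈ Vector (Vector ℤ d) k ] P ≐ convexHull (λ j → lattice (v j))

-- P contains d + 1 affinely independent points, i.e. its affine hull is ℝᵈ.
IsFullDimensional : ∀ {d} → Subset d → Set
IsFullDimensional {d} P =
  Σ[ p ∈ Vector (Vector ℝ d) (suc d) ] ((∀ j → p j ∈ P) × AffinelyIndependent p)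

-- int P ∩ ℤᵈ = {w}
UniqueInteriorLatticePoint : ∀ {d} → Subset d → Vector ℤ d → Set
UniqueInteriorLatticePoint P w = ∀ z → lattice z ∈ interior P ⇔ z ≗ w

record IsFano {d : ℕ} (P : Subset d) : Set where
  field
    latticePolytope : IsLatticePolytope P
    fullDimensional : IsFullDimensional P
    interiorPoints  : UniqueInteriorLatticePoint P (λ _ → + 0)

translate : ∀ {d} → Vector ℝ d → Subset d → Subset d
translate t P y = ∃[ x ] (x ∈ P × y ≈ᵥ (x +ᵥ t))

TranslationEquivalent : ∀ {d} → Subset d → Subset d → Set
TranslationEquivalent {d} P Q = Σ[ t ∈ Vector ℤ d ] Q ≐ translate (lattice t) P

TranslationEquivalentToFano : ∀ {d} → Subset d → Set₁
TranslationEquivalentToFano {d} P = Σ[ Q ∈ Subset d ] (IsFano Q × TranslationEquivalent P Q)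

-- The dimension is d = suc n.  The coordinate xᵢ of the usual 1-based
-- notation is x at the index i - 1: x₁ is x fzero and x_d is x (fromℕ n).
lectureHallPolytope : ∀ {n} (s : Vector ℕ (suc n)) → .{{∀ {i} → NonZero (s i)}} →
  Subset (suc n)
lectureHallPolytope {n} s x =
  0ℝ ≤ℝ x fzero ÷ℕ s fzero ×
  (∀ (i : Fin n) → x (inject₁ i) ÷ℕ s (inject₁ i) ≤ℝ x (fsuc i) ÷ℕ s (fsuc i)) ×
  x (fromℕ n) ÷ℕ s (fromℕ n) ≤ℝ 1ℝ

{-# OPTIONS --safe #-}

-- A lattice point is interior to P exactly when it satisfies the defining
-- inequalities strictly.  If s₁ ≥ 2 then s - 1 does, and so does the point obtained
-- from it by lowering the first coordinate if s₁ > 2, or the coordinate i + 1 if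
-- s_{i+1} > 2 s_i.  If neither happens, the strict inequalities squeeze z_{i+1}
-- between s_{i+1} - 2 and s_{i+1} as soon as z_i = s_i - 1, so s - 1 is the only one.
-- P is a lattice simplex: the ratios x_i / s_i are the partial sums of the
-- barycentric coordinates of x.
module Submission where

open import Defs
open import Algebra.Bundles using (AbelianGroup)
open import Data.Nat.Base as ℕ using (ℕ; zero; suc; NonZero; _≤_; _<_; _*_)
import Data.Nat.Properties as ℕ
open import Data.Nat.Coprimality using (1-coprimeTo) renaming (sym to coprime-sym)
open import Data.Integer.Base as ℤ using (ℤ; +_)
import Data.Integer.Properties as ℤ
import Data.Integer.Solver as ℤ
open import Data.Rational.Base as ℚ using (ℚ; 0ℚ; 1ℚ; ½; _/_; ∣_∣; 1/_; mkℚ; toℚᵘ)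
import Data.Rational.Properties as ℚ
open import Data.Rational.Unnormalised.Base as ℚᵘ using (mkℚᵘ; *≡*)
import Data.Rational.Unnormalised.Properties as ℚᵘ
open import Data.Rational.Solver using (module +-*-Solver)
open import Data.Fin.Base as Fin using (Fin; zero; suc; inject₁; fromℕ)
open import Data.Fin.Properties as Fin using (toℕ-inject₁)
open import Data.Fin.Induction using (<-weakInduction; >-weakInduction)
open import Data.Product.Base using (∃-syntax; _×_; _,_; proj₁; proj₂; map₂)
open import Data.Sum.Base using (inj₁; inj₂)
open import Data.Vec.Functional using (Vector)
open import Function.Base using (_∘_)
open import Function.Bundles using (_⇔_; mk⇔; module Equivalence)
open import Relation.Binary.Core using (_Preserves_⟶_)
open import Relation.Binary.PropositionalEquality
open import Relation.Nullary using (¬_; yes; no; contradiction)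
open import Relation.Unary using (_∈_; _≐_)
open import Algebra.Properties.Group (AbelianGroup.group ℤ.+-0-abelianGroup)
  using (∙-cancelˡ; inverseˡ-unique; //-rightDividesʳ)

open Equivalence using (to; from)

-- Integer points strictly inside

-- Every translate of `P` by an integer vector is a lattice polytope of full dimension, so being
-- Fano up to translation amounts to having exactly one interior lattice point. A Fano witness
-- supplies that point only as the negated translation vector, which is why the arithmetic starts
-- from an arbitrary unique solution `u`. Integrality is what gives a strict solution a whole
-- neighbourhood: each strict inequality between integers has slack at least 1, so one radius suits
-- all of them. Reals are Cauchy sequences compared by `_≈ℝ_`, and a subset is a predicate on
-- representatives. Exact identities are therefore proved term by term over the rationals; an
-- approximate one is obtained by writing its difference sequence as a rational combination of
-- sequences already known to be null.

record StrictlyInside {n} (s : Vector ℕ (suc n)) (z : Vector ℤ (suc n)) : Set where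
  constructor strict
  field
    first : + 0 ℤ.< z zero
    step  : ∀ i → z (inject₁ i) ℤ.* + s (suc i) ℤ.< z (suc i) ℤ.* + s (inject₁ i)
    last  : z (fromℕ n) ℤ.< + s (fromℕ n)

bump : ∀ {n} → Fin n → Fin n → ℕ
bump k i with i Fin.≟ k
... | yes _ = 2
... | no  _ = 1

bump-self : ∀ {n} (k : Fin n) → bump k k ≡ 2
bump-self k with k Fin.≟ k
... | yes _  = refl
... | no k≢k = contradiction refl k≢k

bump-pos : ∀ {n} (k i : Fin n) → 0 < bump k i
bump-pos k i with i Fin.≟ k
... | yes _ = ℕ.z<s
... | no  _ = ℕ.z<s

module _ {n} (s : Vector ℕ (suc n)) .{{_ : ∀ {i} → NonZero (s i)}} where

  StrictlyInside-cong : ∀ {z z′} → z ≗ z′ → StrictlyInside s z → StrictlyInside s z′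
  StrictlyInside-cong z≗z′ (strict first step last) = strict
    (subst (+ 0 ℤ.<_) (z≗z′ zero) first)
    (λ i → subst₂ (λ a b → a ℤ.* + s (suc i) ℤ.< b ℤ.* + s (inject₁ i))
      (z≗z′ (inject₁ i)) (z≗z′ (suc i)) (step i))
    (subst (ℤ._< + s (fromℕ n)) (z≗z′ (fromℕ n)) last)

  -- Downward from the last coordinate: `z i / s i` lies below the next ratio, which is already
  -- below 1.
  StrictlyInside⇒< : ∀ {z} → StrictlyInside s z → ∀ i → z i ℤ.< + s i
  StrictlyInside⇒< {z} (strict _ step last) = >-weakInduction _ last λ i z<s →
    ℤ.*-cancelʳ-<-nonNeg (+ s (suc i)) (begin-strict
      z (inject₁ i) ℤ.* + s (suc i)      <⟨ step i ⟩
      z (suc i) ℤ.* + s (inject₁ i)      ≤⟨ ℤ.*-monoʳ-≤-nonNeg (+ s (inject₁ i)) (ℤ.<⇒≤ z<s) ⟩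
      + s (suc i) ℤ.* + s (inject₁ i)    ≡⟨ ℤ.*-comm (+ s (suc i)) (+ s (inject₁ i)) ⟩
      + s (inject₁ i) ℤ.* + s (suc i)    ∎)
    where open ℤ.≤-Reasoning

  -- In terms of the distance `w` to the upper bound `s`, the product of neighbouring `s` cancels
  -- from both sides of `step`. What is left is a reversed inequality between natural numbers.
  complement-StrictlyInside : (w : Vector ℕ (suc n)) →
    w zero < s zero →
    (∀ i → w (suc i) * s (inject₁ i) < w (inject₁ i) * s (suc i)) →
    0 < w (fromℕ n) →
    StrictlyInside s (λ i → + s i ℤ.- + w i)
  complement-StrictlyInside w first step last = strict
    (subst (ℤ._< + s zero ℤ.- + w zero) (ℤ.+-inverseʳ (+ w zero))
      (ℤ.+-monoˡ-< (ℤ.- + w zero) (ℤ.+<+ first)))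
    (λ i → subst₂ ℤ._<_
      (sym (expandˡ (+ s (inject₁ i)) (+ s (suc i)) (+ w (inject₁ i))))
      (sym (expandʳ (+ s (inject₁ i)) (+ s (suc i)) (+ w (suc i))))
      (ℤ.+-monoʳ-< (+ s (inject₁ i) ℤ.* + s (suc i)) (ℤ.neg-mono-<
        (subst₂ ℤ._<_ (ℤ.pos-* (w (suc i)) (s (inject₁ i))) (ℤ.pos-* (w (inject₁ i)) (s (suc i)))
          (ℤ.+<+ (step i))))))
    (subst (+ s (fromℕ n) ℤ.- + w (fromℕ n) ℤ.<_) (ℤ.+-identityʳ (+ s (fromℕ n)))
      (ℤ.+-monoʳ-< (+ s (fromℕ n)) (ℤ.neg-mono-< (ℤ.+<+ last))))
    where
    open ℤ.+-*-Solver
    expandˡ : ∀ a b c → (a ℤ.- c) ℤ.* b ≡ a ℤ.* b ℤ.+ ℤ.- (c ℤ.* b)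
    expandˡ = solve 3 (λ a b c → (a :- c) :* b := a :* b :+ :- (c :* b)) refl
    expandʳ : ∀ a b c → (b ℤ.- c) ℤ.* a ≡ a ℤ.* b ℤ.+ ℤ.- (c ℤ.* a)
    expandʳ = solve 3 (λ a b c → (b :- c) :* a := a :* b :+ :- (c :* a)) refl

  module _ (s-mono : s Preserves Fin._<_ ⟶ _<_) where

    s-ascends : ∀ i → s (inject₁ i) < s (suc i)
    s-ascends i = s-mono (ℕ.s≤s (ℕ.≤-reflexive (toℕ-inject₁ i)))

    ones-StrictlyInside : 1 < s zero → StrictlyInside s (λ i → + s i ℤ.- + 1)
    ones-StrictlyInside 1<s₀ = complement-StrictlyInside (λ _ → 1) 1<s₀
      (λ i → ℕ.*-monoʳ-< 1 (s-ascends i)) ℕ.z<s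

    -- The 2 hurts only on the left of the inequality, where `k` is `suc i`, and `room` pays for it
    -- there. A 2 on the right helps, so the bound `1 ≤ bump k (inject₁ i)` covers that case
    -- together with the ordinary one. For `k = zero` the premise of `room` is absurd and the cost
    -- moves to `first`.
    bump-StrictlyInside : ∀ k → bump k zero < s zero →
      (∀ i → k ≡ suc i → 2 * s (inject₁ i) < s (suc i)) →
      StrictlyInside s (λ i → + s i ℤ.- + bump k i)
    bump-StrictlyInside k first room =
      complement-StrictlyInside (bump k) first step (bump-pos k (fromℕ n))
      where
      open ℕ.≤-Reasoning
      step : ∀ i → bump k (suc i) * s (inject₁ i) < bump k (inject₁ i) * s (suc i)
      step i with suc i Fin.≟ k
      ... | yes 1+i≡k = begin-strict
        2 * s (inject₁ i)                    <⟨ room i (sym 1+i≡k) ⟩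
        s (suc i)                            ≡⟨ ℕ.*-identityˡ (s (suc i)) ⟨
        1 * s (suc i)                        ≤⟨ ℕ.*-monoˡ-≤ (s (suc i)) (bump-pos k (inject₁ i)) ⟩
        bump k (inject₁ i) * s (suc i)       ∎
      ... | no _ = begin-strict
        1 * s (inject₁ i)                    <⟨ ℕ.*-monoʳ-< 1 (s-ascends i) ⟩
        1 * s (suc i)                        ≤⟨ ℕ.*-monoˡ-≤ (s (suc i)) (bump-pos k (inject₁ i)) ⟩
        bump k (inject₁ i) * s (suc i)       ∎

    module _ {u : Vector ℤ (suc n)}
      (inside : StrictlyInside s u) (unique : ∀ z → StrictlyInside s z → z ≗ u) where

      -- The existence of `u` forces this: the integer `u zero` lies strictly between 0 and
      -- `s zero`.
      unique⇒1<s₀ : 1 < s zero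
      unique⇒1<s₀ = ℤ.drop‿+<+ (ℤ.≤-<-trans (ℤ.i<j⇒suc[i]≤j (StrictlyInside.first inside)) (StrictlyInside⇒< inside zero))

      -- No formula for `u` is given; it is identified through a point already known to be inside.
      unique⇒ones : u ≗ (λ i → + s i ℤ.- + 1)
      unique⇒ones i = sym (unique _ (ones-StrictlyInside unique⇒1<s₀) i)

      bump-not-inside : ∀ k → ¬ StrictlyInside s (λ i → + s i ℤ.- + bump k i)
      bump-not-inside k bumped = contradiction 2≡1 λ ()
        where
        2≡1 : + 2 ≡ + 1
        2≡1 = trans (cong +_ (sym (bump-self k))) (ℤ.neg-injective
          (∙-cancelˡ (+ s k) _ _ (trans (unique _ bumped k) (unique⇒ones k))))

      unique⇒s₀≡2 : s zero ≡ 2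
      unique⇒s₀≡2 = ℕ.≤-antisym
        (ℕ.≮⇒≥ λ 2<s₀ → bump-not-inside zero (bump-StrictlyInside zero 2<s₀ λ _ ()))
        unique⇒1<s₀

      unique⇒≤2* : ∀ i → s (suc i) ≤ 2 * s (inject₁ i)
      unique⇒≤2* i = ℕ.≮⇒≥ λ 2s<s → bump-not-inside (suc i)
        (bump-StrictlyInside (suc i) unique⇒1<s₀ λ { _ refl → 2s<s })

    ones-unique : s zero ≡ 2 → (∀ i → s (suc i) ≤ 2 * s (inject₁ i)) →
      ∀ {z} → StrictlyInside s z → z ≗ (λ i → + s i ℤ.- + 1)
    ones-unique s₀≡2 s≤2s {z} inside@(strict first step _) = <-weakInduction _
      (squeeze (s zero) (z zero)
        -- With `s zero` equal to 2, the inequality `0 < z zero` is the lower bound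
        -- `s zero - 2 < z zero`.
        (subst (λ m → + m ℤ.- + 2 ℤ.< z zero) (sym s₀≡2) first) (StrictlyInside⇒< inside zero))
      λ i z≡s-1 → squeeze (s (suc i)) (z (suc i))
        (ℤ.*-cancelʳ-<-nonNeg (+ s (inject₁ i)) (below i z≡s-1)) (StrictlyInside⇒< inside (suc i))
      where
      open ℤ.+-*-Solver
      open ℤ.≤-Reasoning
      squeeze : ∀ m z → + m ℤ.- + 2 ℤ.< z → z ℤ.< + m → z ≡ + m ℤ.- + 1
      squeeze m z m-2<z z<m = ℤ.≤-antisym
        (subst (z ℤ.≤_) (ℤ.+-comm (ℤ.- + 1) (+ m)) (ℤ.i<j⇒i≤pred[j] z<m))
        (subst (ℤ._≤ z) (solve 1 (λ m → con (+ 1) :+ (m :- con (+ 2)) := m :- con (+ 1)) refl (+ m))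
          (ℤ.i<j⇒suc[i]≤j m-2<z))
      -- The lower bound for the next coordinate, multiplied by `s (inject₁ i)`. The doubling
      -- condition enters as `- 2 a ≤ - b`, which turns `(b - 2) a` into at most `(a - 1) b`.
      below : ∀ i → z (inject₁ i) ≡ + s (inject₁ i) ℤ.- + 1 →
        (+ s (suc i) ℤ.- + 2) ℤ.* + s (inject₁ i) ℤ.< z (suc i) ℤ.* + s (inject₁ i)
      below i z≡s-1 = begin-strict
        (+ b ℤ.- + 2) ℤ.* + a                    ≡⟨ solve 2 (λ a b → (b :- con (+ 2)) :* a := a :* b :- con (+ 2) :* a) refl (+ a) (+ b) ⟩
        + a ℤ.* + b ℤ.- + 2 ℤ.* + a              ≡⟨ cong (λ c → + a ℤ.* + b ℤ.- c) (ℤ.pos-* 2 a) ⟨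
        + a ℤ.* + b ℤ.- + (2 * a)                ≤⟨ ℤ.+-monoʳ-≤ (+ a ℤ.* + b) (ℤ.neg-mono-≤ (ℤ.+≤+ (s≤2s i))) ⟩
        + a ℤ.* + b ℤ.- + b                      ≡⟨ solve 2 (λ a b → a :* b :- b := (a :- con (+ 1)) :* b) refl (+ a) (+ b) ⟩
        (+ a ℤ.- + 1) ℤ.* + b                    ≡⟨ cong (ℤ._* + b) z≡s-1 ⟨
        z (inject₁ i) ℤ.* + b                    <⟨ step i ⟩
        z (suc i) ℤ.* + a                        ∎
        where
        a b : ℕ
        a = s (inject₁ i)
        b = s (suc i)

-- Rationals and limits of rational sequences

open +-*-Solver using (solve; _:+_; _:*_; _:-_; :-_; _:=_; con)

p≤q⇒0≤q-p : ∀ {p q} → p ℚ.≤ q → 0ℚ ℚ.≤ q ℚ.- p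
p≤q⇒0≤q-p {p} {q} p≤q = subst (ℚ._≤ q ℚ.- p) (ℚ.+-inverseʳ p) (ℚ.+-monoˡ-≤ (ℚ.- p) p≤q)

0≤q-p⇒p≤q : ∀ {p q} → 0ℚ ℚ.≤ q ℚ.- p → p ℚ.≤ q
0≤q-p⇒p≤q {p} {q} 0≤q-p = subst₂ ℚ._≤_ (ℚ.+-identityˡ p)
  (solve 2 (λ p q → (q :- p) :+ p := q) refl p q) (ℚ.+-monoˡ-≤ p 0≤q-p)

-- `z / 1` is normalised through a gcd and is stuck on a variable. From the canonical form with
-- denominator 1, sums, products and comparisons compute.
integer : ∀ z → z / 1 ≡ mkℚ z 0 (coprime-sym (1-coprimeTo ℤ.∣ z ∣))
integer z = ℚ.↥p/↧p≡p (mkℚ z 0 (coprime-sym (1-coprimeTo ℤ.∣ z ∣)))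

/1-+ : ∀ a b → (a ℤ.+ b) / 1 ≡ a / 1 ℚ.+ b / 1
/1-+ a b = trans (cong (_/ 1) (sym (cong₂ ℤ._+_ (ℤ.*-identityʳ a) (ℤ.*-identityʳ b))))
  (sym (cong₂ ℚ._+_ (integer a) (integer b)))

/1-* : ∀ a b → (a ℤ.* b) / 1 ≡ a / 1 ℚ.* (b / 1)
/1-* a b = sym (cong₂ ℚ._*_ (integer a) (integer b))

/1-mono-≤ : ∀ {a b} → a ℤ.≤ b → a / 1 ℚ.≤ b / 1
/1-mono-≤ {a} {b} a≤b = subst₂ ℚ._≤_ (sym (integer a)) (sym (integer b))
  (ℚ.*≤* (subst₂ ℤ._≤_ (sym (ℤ.*-identityʳ a)) (sym (ℤ.*-identityʳ b)) a≤b))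

/1-mono-< : ∀ {a b} → a ℤ.< b → a / 1 ℚ.< b / 1
/1-mono-< {a} {b} a<b = subst₂ ℚ._<_ (sym (integer a)) (sym (integer b))
  (ℚ.*<* (subst₂ ℤ._<_ (sym (ℤ.*-identityʳ a)) (sym (ℤ.*-identityʳ b)) a<b))

/1-cancel-< : ∀ {a b} → a / 1 ℚ.< b / 1 → a ℤ.< b
/1-cancel-< {a} {b} a<b with subst₂ ℚ._<_ (integer a) (integer b) a<b
... | ℚ.*<* a<b = subst₂ ℤ._<_ (ℤ.*-identityʳ a) (ℤ.*-identityʳ b) a<b

-- Normalisation blocks computation here as well; among unnormalised rationals only a
-- cross-multiplication remains.
n*1/n≡1 : ∀ n .{{_ : NonZero n}} → + n / 1 ℚ.* (+ 1 / n) ≡ 1ℚ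
n*1/n≡1 n@(suc m) = ℚ.toℚᵘ-injective (begin
  toℚᵘ (+ n / 1 ℚ.* (+ 1 / n))         ≈⟨ ℚ.toℚᵘ-homo-* (+ n / 1) (+ 1 / n) ⟩
  toℚᵘ (+ n / 1) ℚᵘ.* toℚᵘ (+ 1 / n)   ≈⟨ ℚᵘ.*-cong (ℚ.toℚᵘ-fromℚᵘ (mkℚᵘ (+ n) 0)) (ℚ.toℚᵘ-fromℚᵘ (mkℚᵘ (+ 1) m)) ⟩
  mkℚᵘ (+ n) 0 ℚᵘ.* mkℚᵘ (+ 1) m       ≈⟨ *≡* (trans (cong (ℤ._* + 1) (ℤ.*-comm (+ n) (+ 1))) (ℤ.*-comm (+ 1 ℤ.* + n) (+ 1))) ⟩
  ℚᵘ.1ℚᵘ ∎)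
  where open import Relation.Binary.Reasoning.Setoid ℚᵘ.≃-setoid

1/n-positive : ∀ n .{{_ : NonZero n}} → ℚ.Positive (+ 1 / n)
1/n-positive n = ℚ.normalize-pos 1 n

-- `x ≈ℝ y` is by definition `Null` of the termwise difference, so facts about `Null` apply to
-- `_≈ℝ_` as they stand. `Nonneg` plays the same role for `_≤ℝ_`, after moving one term across the
-- inequality.
Null Nonneg : (ℕ → ℚ) → Set
Null a = ∀ ε → 0ℚ ℚ.< ε → ∃[ N ] (∀ n → N ≤ n → ∣ a n ∣ ℚ.< ε)
Nonneg a = ∀ ε → 0ℚ ℚ.< ε → ∃[ N ] (∀ n → N ≤ n → 0ℚ ℚ.≤ a n ℚ.+ ε)

0<½*ε : ∀ {ε} → 0ℚ ℚ.< ε → 0ℚ ℚ.< ½ ℚ.* ε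
0<½*ε {ε} 0<ε = subst (ℚ._< ½ ℚ.* ε) (ℚ.*-zeroʳ ½) (ℚ.*-monoʳ-<-pos ½ 0<ε)

½*ε+½*ε : ∀ ε → ½ ℚ.* ε ℚ.+ ½ ℚ.* ε ≡ ε
½*ε+½*ε ε = trans (sym (ℚ.*-distribʳ-+ ε ½ ½)) (ℚ.*-identityˡ ε)

Null-cong : ∀ {a b} → a ≗ b → Null a → Null b
Null-cong a≗b null ε 0<ε =
  map₂ (λ small n N≤n → subst (λ q → ∣ q ∣ ℚ.< ε) (a≗b n) (small n N≤n)) (null ε 0<ε)

Null-0 : Null (λ _ → 0ℚ)
Null-0 ε 0<ε = 0 , λ _ _ → 0<ε

Null-+ : ∀ {a b} → Null a → Null b → Null (λ n → a n ℚ.+ b n)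
Null-+ {a} {b} α β ε 0<ε with α (½ ℚ.* ε) (0<½*ε 0<ε) | β (½ ℚ.* ε) (0<½*ε 0<ε)
... | M , p | N , q = M ℕ.⊔ N , λ n M⊔N≤n → begin-strict
  ∣ a n ℚ.+ b n ∣        ≤⟨ ℚ.∣p+q∣≤∣p∣+∣q∣ (a n) (b n) ⟩
  ∣ a n ∣ ℚ.+ ∣ b n ∣    <⟨ ℚ.+-mono-< (p n (ℕ.m⊔n≤o⇒m≤o M N M⊔N≤n)) (q n (ℕ.m⊔n≤o⇒n≤o M N M⊔N≤n)) ⟩
  ½ ℚ.* ε ℚ.+ ½ ℚ.* ε    ≡⟨ ½*ε+½*ε ε ⟩
  ε                      ∎
  where open ℚ.≤-Reasoning

-- Dividing ε by ∣q∣ + 1 instead of ∣q∣ covers q = 0.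
rescale : ∀ q ε → 0ℚ ℚ.< ε →
  ∃[ δ ] (0ℚ ℚ.< δ × ∣ q ∣ ℚ.* δ ℚ.≤ ε)
rescale q ε 0<ε = δ , 0<δ , (begin
  ∣ q ∣ ℚ.* δ          ≤⟨ ℚ.*-monoʳ-≤-nonNeg δ {{ℚ.nonNegative (ℚ.<⇒≤ 0<δ)}} ∣q∣≤k ⟩
  k ℚ.* (1/ k ℚ.* ε)   ≡⟨ ℚ.*-assoc k (1/ k) ε ⟨
  k ℚ.* 1/ k ℚ.* ε     ≡⟨ cong (ℚ._* ε) (ℚ.*-inverseʳ k) ⟩
  1ℚ ℚ.* ε             ≡⟨ ℚ.*-identityˡ ε ⟩
  ε                    ∎)
  where
  open ℚ.≤-Reasoning
  k : ℚ
  k = ∣ q ∣ ℚ.+ 1ℚ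
  ∣q∣≤k : ∣ q ∣ ℚ.≤ k
  ∣q∣≤k = subst (ℚ._≤ k) (ℚ.+-identityʳ ∣ q ∣) (ℚ.+-monoʳ-≤ ∣ q ∣ (ℚ.nonNegative⁻¹ 1ℚ))
  instance
    k⁺ : ℚ.Positive k
    k⁺ = ℚ.nonNeg+pos⇒pos ∣ q ∣ {{ℚ.∣-∣-nonNeg q}} 1ℚ
    k≢0 : ℚ.NonZero k
    k≢0 = ℚ.pos⇒nonZero k
  δ : ℚ
  δ = 1/ k ℚ.* ε
  0<δ : 0ℚ ℚ.< δ
  0<δ = subst (ℚ._< δ) (ℚ.*-zeroʳ (1/ k)) (ℚ.*-monoʳ-<-pos (1/ k) {{ℚ.1/pos⇒pos k}} 0<ε)

Null-* : ∀ {a} q → Null a → Null (λ n → q ℚ.* a n)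
-- The estimates through `∣ q ∣` are non-strict; aiming at half of `ε` leaves room for a strict one.
Null-* {a} q α ε 0<ε with rescale q (½ ℚ.* ε) (0<½*ε 0<ε)
... | δ , 0<δ , ∣q∣δ≤½ε with α δ 0<δ
... | N , p = N , λ n N≤n → begin-strict
  ∣ q ℚ.* a n ∣         ≡⟨ ℚ.∣p*q∣≡∣p∣*∣q∣ q (a n) ⟩
  ∣ q ∣ ℚ.* ∣ a n ∣     ≤⟨ ℚ.*-monoˡ-≤-nonNeg ∣ q ∣ {{ℚ.∣-∣-nonNeg q}} (ℚ.<⇒≤ (p n N≤n)) ⟩
  ∣ q ∣ ℚ.* δ           ≤⟨ ∣q∣δ≤½ε ⟩
  ½ ℚ.* ε               ≡⟨ ℚ.+-identityʳ (½ ℚ.* ε) ⟨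
  ½ ℚ.* ε ℚ.+ 0ℚ        <⟨ ℚ.+-monoʳ-< (½ ℚ.* ε) (0<½*ε 0<ε) ⟩
  ½ ℚ.* ε ℚ.+ ½ ℚ.* ε   ≡⟨ ½*ε+½*ε ε ⟩
  ε                     ∎
  where open ℚ.≤-Reasoning

Null-- : ∀ {a b} → Null a → Null b → Null (λ n → a n ℚ.- b n)
Null-- {a} {b} α β = Null-cong
  (λ n → solve 2 (λ a b → a :+ con (ℚ.- 1ℚ) :* b := a :- b) refl (a n) (b n))
  (Null-+ α (Null-* (ℚ.- 1ℚ) β))

Nonneg-cong : ∀ {a b} → a ≗ b → Nonneg a → Nonneg b
Nonneg-cong a≗b nonneg ε 0<ε =
  map₂ (λ p n N≤n → subst (λ q → 0ℚ ℚ.≤ q ℚ.+ ε) (a≗b n) (p n N≤n)) (nonneg ε 0<ε)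

Nonneg-+ : ∀ {a b} → Nonneg a → Nonneg b → Nonneg (λ n → a n ℚ.+ b n)
Nonneg-+ {a} {b} α β ε 0<ε with α (½ ℚ.* ε) (0<½*ε 0<ε) | β (½ ℚ.* ε) (0<½*ε 0<ε)
... | M , p | N , q = M ℕ.⊔ N , λ n M⊔N≤n → begin
  0ℚ                                            ≤⟨ ℚ.+-mono-≤ (p n (ℕ.m⊔n≤o⇒m≤o M N M⊔N≤n)) (q n (ℕ.m⊔n≤o⇒n≤o M N M⊔N≤n)) ⟩
  (a n ℚ.+ ½ ℚ.* ε) ℚ.+ (b n ℚ.+ ½ ℚ.* ε)       ≡⟨ solve 3 (λ a b e → (a :+ e) :+ (b :+ e) := (a :+ b) :+ (e :+ e)) refl (a n) (b n) (½ ℚ.* ε) ⟩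
  (a n ℚ.+ b n) ℚ.+ (½ ℚ.* ε ℚ.+ ½ ℚ.* ε)       ≡⟨ cong ((a n ℚ.+ b n) ℚ.+_) (½*ε+½*ε ε) ⟩
  (a n ℚ.+ b n) ℚ.+ ε                           ∎
  where open ℚ.≤-Reasoning

Null⇒Nonneg : ∀ {a} → Null a → Nonneg a
Null⇒Nonneg {a} null ε 0<ε = map₂ (λ small n N≤n → begin
  0ℚ                                ≡⟨ ℚ.+-inverseˡ (a n) ⟨
  ℚ.- a n ℚ.+ a n                   ≤⟨ ℚ.+-monoˡ-≤ (a n) (p≤∣p∣ (ℚ.- a n)) ⟩
  ∣ ℚ.- a n ∣ ℚ.+ a n               ≡⟨ cong (ℚ._+ a n) (ℚ.∣-p∣≡∣p∣ (a n)) ⟩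
  ∣ a n ∣ ℚ.+ a n                   ≤⟨ ℚ.+-monoˡ-≤ (a n) (ℚ.<⇒≤ (small n N≤n)) ⟩
  ε ℚ.+ a n                         ≡⟨ ℚ.+-comm ε (a n) ⟩
  a n ℚ.+ ε                         ∎) (null ε 0<ε)
  where
  open ℚ.≤-Reasoning
  p≤∣p∣ : ∀ p → p ℚ.≤ ∣ p ∣
  p≤∣p∣ p with ℚ.≤-total 0ℚ p
  ... | inj₁ 0≤p = ℚ.≤-reflexive (sym (ℚ.0≤p⇒∣p∣≡p 0≤p))
  ... | inj₂ p≤0 = ℚ.≤-trans p≤0 (ℚ.0≤∣p∣ p)

≤ℝ⇒Nonneg : ∀ {x y} → x ≤ℝ y → Nonneg (λ n → seq y n ℚ.- seq x n)
≤ℝ⇒Nonneg {x} {y} x≤y ε 0<ε = map₂ (λ p n N≤n →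
  subst (0ℚ ℚ.≤_) (solve 3 (λ x y e → (y :+ e) :- x := (y :- x) :+ e) refl (seq x n) (seq y n) ε)
    (p≤q⇒0≤q-p (p n N≤n))) (x≤y ε 0<ε)

Nonneg⇒≤ℝ : ∀ {y x} → Nonneg (λ n → seq y n ℚ.- seq x n) → x ≤ℝ y
Nonneg⇒≤ℝ {y} {x} x≤y ε 0<ε = map₂ (λ p n N≤n →
  0≤q-p⇒p≤q (subst (0ℚ ℚ.≤_) (solve 3 (λ x y e → (y :- x) :+ e := (y :+ e) :- x) refl (seq x n) (seq y n) ε)
    (p n N≤n))) (x≤y ε 0<ε)

≗⇒≈ℝ : ∀ {x y} → seq x ≗ seq y → x ≈ℝ y
≗⇒≈ℝ {x} {y} x≗y = Null-cong
  (λ n → sym (trans (cong (λ p → seq x n ℚ.- p) (sym (x≗y n))) (ℚ.+-inverseʳ (seq x n)))) Null-0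

eventually-≤⇒≤ℝ : ∀ {x y} → ∃[ N ] (∀ n → N ≤ n → seq x n ℚ.≤ seq y n) → x ≤ℝ y
eventually-≤⇒≤ℝ {x} {y} (N , p) ε 0<ε = N , λ n N≤n → begin
  seq x n          ≤⟨ p n N≤n ⟩
  seq y n          ≡⟨ ℚ.+-identityʳ (seq y n) ⟨
  seq y n ℚ.+ 0ℚ   ≤⟨ ℚ.+-monoʳ-≤ (seq y n) (ℚ.<⇒≤ 0<ε) ⟩
  seq y n ℚ.+ ε    ∎
  where open ℚ.≤-Reasoning

-- Otherwise some rational `m` lies strictly between `q` and `p`, and the tolerance `m - q` would
-- give `p ≤ m`.
fromℚ-cancel-≤ : ∀ {p q} → fromℚ p ≤ℝ fromℚ q → p ℚ.≤ q
fromℚ-cancel-≤ {p} {q} p≤q = ℚ.≮⇒≥ q≮p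
  where
  q≮p : ¬ q ℚ.< p
  q≮p q<p with ℚ.<-dense q<p
  ... | m , q<m , m<p with p≤q (m ℚ.- q) (subst (ℚ._< m ℚ.- q) (ℚ.+-inverseʳ q) (ℚ.+-monoˡ-< (ℚ.- q) q<m))
  ... | N , bound = ℚ.<-irrefl refl (ℚ.<-≤-trans m<p
        (subst (p ℚ.≤_) (solve 2 (λ q m → q :+ (m :- q) := m) refl q m) (bound N ℕ.≤-refl)))

-- The order sees only the termwise difference of its two sides, so this form carries an inequality
-- through a common translation.
<ℝ-cong : ∀ {x y x′ y′} →
  (∀ n → seq y n ℚ.- seq x n ≡ seq y′ n ℚ.- seq x′ n) → x <ℝ y → x′ <ℝ y′
<ℝ-cong {x} {y} {x′} {y′} eq (ε , 0<ε , N , p) = ε , 0<ε , N , λ n N≤n →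
  0≤q-p⇒p≤q (subst (0ℚ ℚ.≤_) (shift n) (p≤q⇒0≤q-p (p n N≤n)))
  where
  reassoc : ∀ p q e → q ℚ.- (p ℚ.+ e) ≡ (q ℚ.- p) ℚ.- e
  reassoc = solve 3 (λ p q e → q :- (p :+ e) := (q :- p) :- e) refl
  shift : ∀ n → seq y n ℚ.- (seq x n ℚ.+ ε) ≡ seq y′ n ℚ.- (seq x′ n ℚ.+ ε)
  shift n = trans (reassoc (seq x n) (seq y n) ε)
    (trans (cong (λ p → p ℚ.- ε) (eq n)) (sym (reassoc (seq x′ n) (seq y′ n) ε)))

≈ℝ-sym : ∀ {x y} → x ≈ℝ y → y ≈ℝ x
≈ℝ-sym {x} {y} x≈y = Null-cong
  (λ n → solve 2 (λ x y → con (ℚ.- 1ℚ) :* (x :- y) := y :- x) refl (seq x n) (seq y n))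
  (Null-* (ℚ.- 1ℚ) x≈y)

≤ℝ-cong : ∀ {x y x′ y′} → x ≈ℝ x′ → y ≈ℝ y′ → x ≤ℝ y → x′ ≤ℝ y′
≤ℝ-cong {x} {y} {x′} {y′} x≈x′ y≈y′ x≤y = Nonneg⇒≤ℝ {y′} {x′} (Nonneg-cong
  (λ n → solve 4 (λ x y x′ y′ → (y :- x) :+ ((x :- x′) :- (y :- y′)) := y′ :- x′) refl
    (seq x n) (seq y n) (seq x′ n) (seq y′ n))
  (Nonneg-+ {λ n → seq y n ℚ.- seq x n} {λ n → (seq x n ℚ.- seq x′ n) ℚ.- (seq y n ℚ.- seq y′ n)}
    (≤ℝ⇒Nonneg {x} {y} x≤y) (Null⇒Nonneg (Null-- x≈x′ y≈y′))))

÷ℕ-cong : ∀ {x y} n .{{_ : NonZero n}} → x ≈ℝ y → x ÷ℕ n ≈ℝ y ÷ℕ n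
÷ℕ-cong {x} {y} n x≈y = Null-cong
  (λ k → solve 3 (λ r x y → r :* (x :- y) := x :* r :- y :* r) refl (+ 1 / n) (seq x k) (seq y k))
  (Null-* (+ 1 / n) x≈y)

≈ℝ-refl : ∀ {x} → x ≈ℝ x
≈ℝ-refl {x} = ≗⇒≈ℝ {x} {x} λ _ → refl

-- Subsets of ℝᵈ and partial sums

-- Not automatic for a predicate on Cauchy sequences. It is what recovers a given point of `P` from
-- membership in a translate, which only yields an equal representative.
Respects-≈ᵥ : ∀ {d} → Subset d → Set
Respects-≈ᵥ P = ∀ x y → x ≈ᵥ y → x ∈ P → y ∈ P

lectureHallPolytope-resp : ∀ {n} (s : Vector ℕ (suc n)) .{{_ : ∀ {i} → NonZero (s i)}} →
  Respects-≈ᵥ (lectureHallPolytope s)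
lectureHallPolytope-resp {n} s x y x≈y (first , step , last) =
  ≤ℝ-cong {0ℝ} {x÷s zero} {0ℝ} {y÷s zero} (≈ℝ-refl {0ℝ}) (x÷s≈y÷s zero) first ,
  (λ i → ≤ℝ-cong {x÷s (inject₁ i)} {x÷s (suc i)} {y÷s (inject₁ i)} {y÷s (suc i)}
    (x÷s≈y÷s (inject₁ i)) (x÷s≈y÷s (suc i)) (step i)) ,
  ≤ℝ-cong {x÷s (fromℕ n)} {1ℝ} {y÷s (fromℕ n)} {1ℝ} (x÷s≈y÷s (fromℕ n)) (≈ℝ-refl {1ℝ}) last
  where
  x÷s y÷s : Vector ℝ (suc n)
  x÷s i = x i ÷ℕ s i
  y÷s i = y i ÷ℕ s i
  x÷s≈y÷s : x÷s ≈ᵥ y÷s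
  x÷s≈y÷s i = ÷ℕ-cong {x i} {y i} (s i) (x≈y i)

module _ {d} {P Q : Subset d} (P-resp : Respects-≈ᵥ P) (t : Vector ℤ d)
  (Q≐P+t : Q ≐ translate (lattice t) P) (z z′ : Vector ℤ d) (z′≗z+t : ∀ i → z′ i ≡ z i ℤ.+ t i) where

  private
    τ : Fin d → ℚ
    τ i = t i / 1

    shift-lower : ∀ i y e → y ℚ.- (z i / 1 ℚ.- e) ≡ (y ℚ.+ τ i) ℚ.- (z′ i / 1 ℚ.- e)
    shift-lower i y e = trans
      (solve 4 (λ y z t e → y :- (z :- e) := (y :+ t) :- ((z :+ t) :- e)) refl y (z i / 1) (τ i) e)
      (cong (λ q → (y ℚ.+ τ i) ℚ.- (q ℚ.- e)) (sym (trans (cong (_/ 1) (z′≗z+t i)) (/1-+ (z i) (t i)))))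

    shift-upper : ∀ i y e → (z i / 1 ℚ.+ e) ℚ.- y ≡ (z′ i / 1 ℚ.+ e) ℚ.- (y ℚ.+ τ i)
    shift-upper i y e = trans
      (solve 4 (λ y z t e → (z :+ e) :- y := ((z :+ t) :+ e) :- (y :+ t)) refl y (z i / 1) (τ i) e)
      (cong (λ q → (q ℚ.+ e) ℚ.- (y ℚ.+ τ i)) (sym (trans (cong (_/ 1) (z′≗z+t i)) (/1-+ (z i) (t i)))))

    cancel : ∀ y t → (y ℚ.- t) ℚ.+ t ≡ y
    cancel = solve 2 (λ y t → (y :- t) :+ t := y) refl

  -- The same radius works on both sides, since a translation moves a cube to a cube. `z′` is tied
  -- to `z + t` by a pointwise equation, so that vectors such as `λ _ → + 0` can be plugged in
  -- without function extensionality.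
  interior-translate : lattice z ∈ interior P ⇔ lattice z′ ∈ interior Q
  interior-translate = mk⇔
    (λ { (ε , 0<ε , nbhd) → ε , 0<ε , λ y near → proj₂ Q≐P+t
      ( (λ i → y i -ℝ lattice t i)
      , nbhd _ (λ i →
          <ℝ-cong {lattice z′ i -ℝ ε} {y i} {lattice z i -ℝ ε} {y i -ℝ lattice t i}
            (λ n → sym (trans (shift-lower i (seq (y i) n ℚ.- τ i) (seq ε n))
              (cong (λ q → q ℚ.- (z′ i / 1 ℚ.- seq ε n)) (cancel (seq (y i) n) (τ i)))))
            (proj₁ (near i)) ,
          <ℝ-cong {y i} {lattice z′ i +ℝ ε} {y i -ℝ lattice t i} {lattice z i +ℝ ε}
            (λ n → sym (trans (shift-upper i (seq (y i) n ℚ.- τ i) (seq ε n))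
              (cong (λ q → (z′ i / 1 ℚ.+ seq ε n) ℚ.- q) (cancel (seq (y i) n) (τ i)))))
            (proj₂ (near i)))
      , λ i → ≗⇒≈ℝ {y i} {(y i -ℝ lattice t i) +ℝ lattice t i}
          (λ n → sym (cancel (seq (y i) n) (τ i)))) })
    (λ { (ε , 0<ε , nbhd) → ε , 0<ε , λ y near →
      -- The witness `x` need not be `y` itself; cancelling `t` gives only `x ≈ᵥ y`.
      let (x , x∈P , y+t≈x+t) = proj₁ Q≐P+t (nbhd (y +ᵥ lattice t) λ i →
            <ℝ-cong {lattice z i -ℝ ε} {y i} {lattice z′ i -ℝ ε} {y i +ℝ lattice t i}
              (λ n → shift-lower i (seq (y i) n) (seq ε n)) (proj₁ (near i)) ,
            <ℝ-cong {y i} {lattice z i +ℝ ε} {y i +ℝ lattice t i} {lattice z′ i +ℝ ε}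
              (λ n → shift-upper i (seq (y i) n) (seq ε n)) (proj₂ (near i)))
      in P-resp x y (λ i → ≈ℝ-sym {y i} {x i} (Null-cong
        (λ n → solve 3 (λ y x t → (y :+ t) :- (x :+ t) := y :- x) refl (seq (y i) n) (seq (x i) n) (τ i))
        (y+t≈x+t i))) x∈P })

-- For barycentric coordinates `c` these are the ratios `x i / s i`. The full sum is left out: it is
-- the constant 1 that ends the chain of ratios.
prefix : ∀ {m} → Vector ℝ (suc m) → Vector ℝ m
prefix c zero    = c zero
prefix c (suc i) = c zero +ℝ prefix (c ∘ suc) i

prefix-ascends : ∀ {m} (c : Vector ℝ (suc (suc m))) → (∀ j → 0ℝ ≤ℝ c j) →
  ∀ i → prefix c (inject₁ i) ≤ℝ prefix c (suc i)
prefix-ascends c 0≤c zero = Nonneg⇒≤ℝ {c zero +ℝ c (suc zero)} {c zero} (Nonneg-cong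
  (λ n → solve 2 (λ a b → b :- con 0ℚ := (a :+ b) :- a) refl (seq (c zero) n) (seq (c (suc zero)) n))
  (≤ℝ⇒Nonneg {0ℝ} {c (suc zero)} (0≤c (suc zero))))
prefix-ascends {suc m} c 0≤c (suc i) = Nonneg⇒≤ℝ {c zero +ℝ p} {c zero +ℝ q} (Nonneg-cong
  (λ n → solve 3 (λ a p q → p :- q := (a :+ p) :- (a :+ q)) refl (seq (c zero) n) (seq p n) (seq q n))
  (≤ℝ⇒Nonneg {q} {p} (prefix-ascends (c ∘ suc) (0≤c ∘ suc) i)))
  where
  p q : ℝ
  p = prefix (c ∘ suc) (suc i)
  q = prefix (c ∘ suc) (inject₁ i)

prefix-last≤∑ : ∀ {m} (c : Vector ℝ (suc (suc m))) → (∀ j → 0ℝ ≤ℝ c j) →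
  prefix c (fromℕ m) ≤ℝ ∑ c
prefix-last≤∑ {zero} c 0≤c = Nonneg⇒≤ℝ {∑ c} {c zero} (Nonneg-cong
  (λ n → solve 2 (λ a b → b :- con 0ℚ := (a :+ (b :+ con 0ℚ)) :- a) refl (seq (c zero) n) (seq (c (suc zero)) n))
  (≤ℝ⇒Nonneg {0ℝ} {c (suc zero)} (0≤c (suc zero))))
prefix-last≤∑ {suc m} c 0≤c = Nonneg⇒≤ℝ {∑ c} {c zero +ℝ q} (Nonneg-cong
  (λ n → solve 3 (λ a p q → p :- q := (a :+ p) :- (a :+ q)) refl (seq (c zero) n) (seq (∑ (c ∘ suc)) n) (seq q n))
  (≤ℝ⇒Nonneg {q} {∑ (c ∘ suc)} (prefix-last≤∑ (c ∘ suc) (0≤c ∘ suc))))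
  where
  q : ℝ
  q = prefix (c ∘ suc) (fromℕ m)

-- Each entry is the difference of two consecutive partial sums; the total supplies the last one.
prefix≈0⇒≈0 : ∀ {m} (c : Vector ℝ (suc m)) → prefix c ≈ᵥ 0ᵥ → ∑ c ≈ℝ 0ℝ → ∀ j → c j ≈ℝ 0ℝ
prefix≈0⇒≈0 {zero} c _ ∑≈0 zero = Null-cong
  (λ n → cong (ℚ._- 0ℚ) (ℚ.+-identityʳ (seq (c zero) n))) ∑≈0
prefix≈0⇒≈0 {suc m} c prefix≈0 _ zero = prefix≈0 zero
prefix≈0⇒≈0 {suc m} c prefix≈0 ∑≈0 (suc j) = prefix≈0⇒≈0 (c ∘ suc)
  (λ i → drop-head (prefix (c ∘ suc) i) (prefix≈0 (suc i))) (drop-head (∑ (c ∘ suc)) ∑≈0) j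
  where
  drop-head : ∀ x → c zero +ℝ x ≈ℝ 0ℝ → x ≈ℝ 0ℝ
  drop-head x c₀+x≈0 = Null-cong
    (λ n → solve 2 (λ a b → ((a :+ b) :- con 0ℚ) :- (a :- con 0ℚ) := b :- con 0ℚ) refl (seq (c zero) n) (seq x n))
    (Null-- c₀+x≈0 (prefix≈0 zero))

-- The inverse of `prefix`: successive differences along the chain `p`, `t`, 1. The previous value
-- `p` is a parameter for the sake of the recursion; the chain of ratios starts at 0.
increments : ∀ {m} → ℝ → Vector ℝ m → Vector ℝ (suc m)
increments {zero}  p t zero    = 1ℝ -ℝ p
increments {suc m} p t zero    = t zero -ℝ p
increments {suc m} p t (suc j) = increments (t zero) (t ∘ suc) j

prefix-increments : ∀ {m} p (t : Vector ℝ m) i k →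
  seq (prefix (increments p t) i) k ≡ seq (t i) k ℚ.- seq p k
prefix-increments p t zero    k = refl
prefix-increments p t (suc i) k = trans
  (cong ((seq (t zero) k ℚ.- seq p k) ℚ.+_) (prefix-increments (t zero) (t ∘ suc) i k))
  (solve 3 (λ a p q → (a :- p) :+ (q :- a) := q :- p) refl (seq (t zero) k) (seq p k) (seq (t (suc i)) k))

∑-increments : ∀ {m} p (t : Vector ℝ m) k → seq (∑ (increments p t)) k ≡ 1ℚ ℚ.- seq p k
∑-increments {zero}  p t k = ℚ.+-identityʳ (1ℚ ℚ.- seq p k)
∑-increments {suc m} p t k = trans
  (cong ((seq (t zero) k ℚ.- seq p k) ℚ.+_) (∑-increments (t zero) (t ∘ suc) k))
  (solve 3 (λ a p q → (a :- p) :+ (q :- a) := q :- p) refl (seq (t zero) k) (seq p k) 1ℚ)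

≤ℝ⇒0≤- : ∀ {x y} → x ≤ℝ y → 0ℝ ≤ℝ y -ℝ x
≤ℝ⇒0≤- {x} {y} x≤y = Nonneg⇒≤ℝ {y -ℝ x} {0ℝ} (Nonneg-cong
  (λ n → solve 2 (λ x y → y :- x := (y :- x) :- con 0ℚ) refl (seq x n) (seq y n)) (≤ℝ⇒Nonneg {x} {y} x≤y))

increments-nonneg : ∀ {m} p (t : Vector ℝ (suc m)) → p ≤ℝ t zero →
  (∀ i → t (inject₁ i) ≤ℝ t (suc i)) → t (fromℕ m) ≤ℝ 1ℝ → ∀ j → 0ℝ ≤ℝ increments p t j
increments-nonneg p t p≤t₀ _ _ zero = ≤ℝ⇒0≤- {p} {t zero} p≤t₀
increments-nonneg {zero} p t _ _ last (suc zero) = ≤ℝ⇒0≤- {t zero} {1ℝ} last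
increments-nonneg {suc m} p t _ step last (suc j) =
  increments-nonneg (t zero) (t ∘ suc) (step zero) (step ∘ suc) last j

-- The value is 1 exactly when `j` is at most `i`: `j` zeros followed by ones, the ratios of the
-- `j`-th vertex.
indicator : ∀ {m} → Fin (suc m) → Fin m → ℕ
indicator zero    i       = 1
indicator (suc j) zero    = 0
indicator (suc j) (suc i) = indicator j i

indicator≤1 : ∀ {m} (j : Fin (suc m)) i → indicator j i ≤ 1
indicator≤1 zero    i       = ℕ.≤-refl
indicator≤1 (suc j) zero    = ℕ.z≤n
indicator≤1 (suc j) (suc i) = indicator≤1 j i

indicator-ascends : ∀ {m} (j : Fin (suc (suc m))) i → indicator j (inject₁ i) ≤ indicator j (suc i)
indicator-ascends zero    i       = ℕ.≤-refl
indicator-ascends (suc j) zero    = ℕ.z≤n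
indicator-ascends {suc m} (suc j) (suc i) = indicator-ascends j i

-- The `j` with indicator 1 at `i` are those up to `i`, so `σ` collects a partial sum, while `τ`
-- multiplies the whole sum. The factor `∑ c` is kept because it is only approximately 1 for convex
-- combinations, and approximately 0 for affine dependences.
∑-indicator : ∀ {m} (c : Vector ℝ (suc m)) σ τ i k →
  seq (∑ (λ j → c j *ℝ fromℤ (+ (indicator j i * σ) ℤ.+ τ))) k ≡
  + σ / 1 ℚ.* seq (prefix c i) k ℚ.+ seq (∑ c) k ℚ.* (τ / 1)
∑-indicator c σ τ zero k = trans
  (cong₂ (λ p q → seq (c zero) k ℚ.* p ℚ.+ q)
    (trans (cong (λ m → (+ m ℤ.+ τ) / 1) (ℕ.*-identityˡ σ)) (/1-+ (+ σ) τ))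
    (trans (∑-*-const (c ∘ suc) (+ 0 ℤ.+ τ)) (cong (λ z → seq (∑ (c ∘ suc)) k ℚ.* (z / 1)) (ℤ.+-identityˡ τ))))
  (solve 4 (λ a b σ τ → a :* (σ :+ τ) :+ b :* τ := σ :* a :+ (a :+ b) :* τ) refl
    (seq (c zero) k) (seq (∑ (c ∘ suc)) k) (+ σ / 1) (τ / 1))
  where
  ∑-*-const : ∀ {m} (c : Vector ℝ m) z → seq (∑ (λ j → c j *ℝ fromℤ z)) k ≡ seq (∑ c) k ℚ.* (z / 1)
  ∑-*-const {zero}  c z = sym (ℚ.*-zeroˡ (z / 1))
  ∑-*-const {suc m} c z = trans (cong (seq (c zero) k ℚ.* (z / 1) ℚ.+_) (∑-*-const (c ∘ suc) z))
    (sym (ℚ.*-distribʳ-+ (z / 1) (seq (c zero) k) (seq (∑ (c ∘ suc)) k)))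
∑-indicator c σ τ (suc i) k = trans
  (cong₂ (λ p q → seq (c zero) k ℚ.* p ℚ.+ q)
    (trans (cong (λ m → (+ m ℤ.+ τ) / 1) (ℕ.*-identityˡ σ)) (/1-+ (+ σ) τ))
    (∑-indicator (c ∘ suc) σ τ i k))
  (solve 5 (λ a b p σ τ → a :* (σ :+ τ) :+ (σ :* p :+ b :* τ) := σ :* (a :+ p) :+ (a :+ b) :* τ) refl
    (seq (c zero) k) (seq (∑ (c ∘ suc)) k) (seq (prefix (c ∘ suc) i) k) (+ σ / 1) (τ / 1))

-- The lecture hall polytope

-- Multiplication by `u′ * v′`. With abstract inverse pairs, one proof serves both to clear
-- denominators and to divide.
cross-multiply : ∀ p q {u v u′ v′} → u ℚ.* u′ ≡ 1ℚ → v ℚ.* v′ ≡ 1ℚ →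
  .{{ℚ.NonNegative u′}} → .{{ℚ.NonNegative v′}} →
  p ℚ.* u ℚ.≤ q ℚ.* v → p ℚ.* v′ ℚ.≤ q ℚ.* u′
cross-multiply p q {u} {v} {u′} {v′} uu′≡1 vv′≡1 pu≤qv = begin
  p ℚ.* v′                      ≡⟨ ℚ.*-identityʳ (p ℚ.* v′) ⟨
  p ℚ.* v′ ℚ.* 1ℚ               ≡⟨ cong (p ℚ.* v′ ℚ.*_) uu′≡1 ⟨
  p ℚ.* v′ ℚ.* (u ℚ.* u′)       ≡⟨ solve 4 (λ p u u′ v′ → p :* v′ :* (u :* u′) := p :* u :* u′ :* v′) refl p u u′ v′ ⟩
  p ℚ.* u ℚ.* u′ ℚ.* v′         ≤⟨ ℚ.*-monoʳ-≤-nonNeg v′ (ℚ.*-monoʳ-≤-nonNeg u′ pu≤qv) ⟩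
  q ℚ.* v ℚ.* u′ ℚ.* v′         ≡⟨ solve 4 (λ q v u′ v′ → q :* v :* u′ :* v′ := q :* u′ :* (v :* v′)) refl q v u′ v′ ⟩
  q ℚ.* u′ ℚ.* (v ℚ.* v′)       ≡⟨ cong (q ℚ.* u′ ℚ.*_) vv′≡1 ⟩
  q ℚ.* u′ ℚ.* 1ℚ               ≡⟨ ℚ.*-identityʳ (q ℚ.* u′) ⟩
  q ℚ.* u′                      ∎
  where open ℚ.≤-Reasoning

module _ {n} (s : Vector ℕ (suc n)) .{{_ : ∀ {i} → NonZero (s i)}} where

  private
    S r : Fin (suc n) → ℚ
    S i = + s i / 1
    r i = + 1 / s i

    S*r≡1 : ∀ i → S i ℚ.* r i ≡ 1ℚ
    S*r≡1 i = n*1/n≡1 (s i)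

    r*S≡1 : ∀ i → r i ℚ.* S i ≡ 1ℚ
    r*S≡1 i = trans (ℚ.*-comm (r i) (S i)) (S*r≡1 i)

    instance
      r-positive : ∀ {i} → ℚ.Positive (r i)
      r-positive {i} = 1/n-positive (s i)
      r-nonNegative : ∀ {i} → ℚ.NonNegative (r i)
      r-nonNegative {i} = ℚ.pos⇒nonNeg (r i)
      S-nonNegative : ∀ {i} → ℚ.NonNegative (S i)
      S-nonNegative {i} = ℚ.nonNegative (/1-mono-≤ {+ 0} {+ s i} (ℤ.+≤+ ℕ.z≤n))

    clear-denominators : ∀ p q i j → p ℚ.* r i ℚ.≤ q ℚ.* r j → p ℚ.* S j ℚ.≤ q ℚ.* S i
    clear-denominators p q i j = cross-multiply p q {r i} {r j} {S i} {S j} (r*S≡1 i) (r*S≡1 j)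

    divide : ∀ p q i j → p ℚ.* S i ℚ.≤ q ℚ.* S j → p ℚ.* r j ℚ.≤ q ℚ.* r i
    divide p q i j = cross-multiply p q {S i} {S j} {r i} {r j} (S*r≡1 i) (S*r≡1 j)

    *r-mono : ∀ i {p q} → p ℚ.≤ q → p ℚ.* r i ℚ.≤ q ℚ.* r i
    *r-mono i = ℚ.*-monoʳ-≤-nonNeg (r i)

  -- Lattice points in the topological interior.

  module _ (s-mono : s Preserves Fin._<_ ⟶ _<_) where

    private
      s≤last : ∀ i → s i ≤ s (fromℕ n)
      s≤last = >-weakInduction _ ℕ.≤-refl λ i → ℕ.≤-trans (ℕ.<⇒≤ (s-ascends s s-mono i))

    -- Moving two neighbouring coordinates by at most `e` brings their cross products closer by at
    -- most `e * (S a + S b)`. This is at most 1, the slack of a strict inequality between integers.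
    StrictlyInside⇒interior : ∀ {z} → StrictlyInside s z → lattice z ∈ interior (lectureHallPolytope s)
    StrictlyInside⇒interior {z} (strict first step last) =
      fromℚ e , (e , 0<e , 0 , λ _ _ → ℚ.≤-reflexive (ℚ.+-identityˡ e)) , λ y near →
        eventually-≤⇒≤ℝ {0ℝ} {y zero ÷ℕ s zero}
          (map₂ (λ p k N≤k → 0≤*r (ℚ.≤-trans 0≤z₀-e (p k N≤k))) (lower y near zero)) ,
        (λ i → let (M , p) = upper y near (inject₁ i) ; (N , q) = lower y near (suc i) in
          eventually-≤⇒≤ℝ {y (inject₁ i) ÷ℕ s (inject₁ i)} {y (suc i) ÷ℕ s (suc i)}
            (M ℕ.⊔ N , λ k M⊔N≤k → begin
              seq (y (inject₁ i)) k ℚ.* r (inject₁ i)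
                ≤⟨ *r-mono (inject₁ i) (p k (ℕ.m⊔n≤o⇒m≤o M N M⊔N≤k)) ⟩
              (Z (inject₁ i) ℚ.+ e) ℚ.* r (inject₁ i)
                ≤⟨ divide (Z (inject₁ i) ℚ.+ e) (Z (suc i) ℚ.- e) (suc i) (inject₁ i) (separated i) ⟩
              (Z (suc i) ℚ.- e) ℚ.* r (suc i)
                ≤⟨ *r-mono (suc i) (q k (ℕ.m⊔n≤o⇒n≤o M N M⊔N≤k)) ⟩
              seq (y (suc i)) k ℚ.* r (suc i) ∎)) ,
        eventually-≤⇒≤ℝ {y (fromℕ n) ÷ℕ s (fromℕ n)} {1ℝ}
          (map₂ (λ p k N≤k → begin
              seq (y (fromℕ n)) k ℚ.* r (fromℕ n)
                ≤⟨ *r-mono (fromℕ n) (ℚ.≤-trans (p k N≤k) zₗ+e≤S) ⟩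
              S (fromℕ n) ℚ.* r (fromℕ n)
                ≡⟨ S*r≡1 (fromℕ n) ⟩
              1ℚ ∎) (upper y near (fromℕ n)))
      where
      open ℚ.≤-Reasoning
      Z : Fin (suc n) → ℚ
      Z i = z i / 1
      p≤p+q : ∀ {p q} → 0ℚ ℚ.≤ q → p ℚ.≤ p ℚ.+ q
      p≤p+q {p} {q} 0≤q = subst (ℚ._≤ p ℚ.+ q) (ℚ.+-identityʳ p) (ℚ.+-monoʳ-≤ p 0≤q)
      -- The margin works because s (fromℕ n) is the largest of the s i.
      e : ℚ
      e = ½ ℚ.* r (fromℕ n)
      0<e : 0ℚ ℚ.< e
      0<e = 0<½*ε (ℚ.positive⁻¹ (r (fromℕ n)))
      instance
        e-nonNegative : ℚ.NonNegative e
        e-nonNegative = ℚ.nonNegative (ℚ.<⇒≤ 0<e)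
      module _ (y : Vector ℝ (suc n))
        (near : ∀ i → (lattice z i -ℝ fromℚ e) <ℝ y i × y i <ℝ (lattice z i +ℝ fromℚ e)) where
        lower : ∀ i → ∃[ N ] (∀ k → N ≤ k → Z i ℚ.- e ℚ.≤ seq (y i) k)
        lower i = let (δ , 0<δ , N , p) = proj₁ (near i) in
          N , λ k N≤k → ℚ.≤-trans (p≤p+q {Z i ℚ.- e} (ℚ.<⇒≤ 0<δ)) (p k N≤k)
        upper : ∀ i → ∃[ N ] (∀ k → N ≤ k → seq (y i) k ℚ.≤ Z i ℚ.+ e)
        upper i = let (δ , 0<δ , N , p) = proj₂ (near i) in
          N , λ k N≤k → ℚ.≤-trans (p≤p+q {seq (y i) k} (ℚ.<⇒≤ 0<δ)) (p k N≤k)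
      e*S≤½ : ∀ i → e ℚ.* S i ℚ.≤ ½
      e*S≤½ i = begin
        e ℚ.* S i                               ≤⟨ ℚ.*-monoˡ-≤-nonNeg e (/1-mono-≤ {+ s i} {+ s (fromℕ n)} (ℤ.+≤+ (s≤last i))) ⟩
        ½ ℚ.* r (fromℕ n) ℚ.* S (fromℕ n)       ≡⟨ ℚ.*-assoc ½ (r (fromℕ n)) (S (fromℕ n)) ⟩
        ½ ℚ.* (r (fromℕ n) ℚ.* S (fromℕ n))     ≡⟨ cong (½ ℚ.*_) (r*S≡1 (fromℕ n)) ⟩
        ½ ∎
      e≤1 : e ℚ.≤ 1ℚ
      e≤1 = begin
        e                  ≡⟨ ℚ.*-identityʳ e ⟨
        e ℚ.* 1ℚ           ≤⟨ ℚ.*-monoˡ-≤-nonNeg e (/1-mono-≤ {+ 1} {+ s zero} (ℤ.+≤+ (ℕ.>-nonZero⁻¹ (s zero)))) ⟩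
        e ℚ.* S zero       ≤⟨ e*S≤½ zero ⟩
        ½                  ≤⟨ ℚ.≤ᵇ⇒≤ _ ⟩
        1ℚ ∎
      0≤z₀-e : 0ℚ ℚ.≤ Z zero ℚ.- e
      0≤z₀-e = p≤q⇒0≤q-p (ℚ.≤-trans e≤1 (/1-mono-≤ {+ 1} (ℤ.i<j⇒suc[i]≤j first)))
      0≤*r : ∀ {p} → 0ℚ ℚ.≤ p → 0ℚ ℚ.≤ p ℚ.* r zero
      0≤*r {p} 0≤p = subst (ℚ._≤ p ℚ.* r zero) (ℚ.*-zeroˡ (r zero)) (*r-mono zero 0≤p)
      separated : ∀ i → (Z (inject₁ i) ℚ.+ e) ℚ.* S (suc i) ℚ.≤ (Z (suc i) ℚ.- e) ℚ.* S (inject₁ i)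
      separated i = begin
        (Z a ℚ.+ e) ℚ.* S b
          ≡⟨ solve 4 (λ z e a b → (z :+ e) :* b := (z :* b :+ (e :* b :+ e :* a)) :- e :* a) refl (Z a) e (S a) (S b) ⟩
        Z a ℚ.* S b ℚ.+ (e ℚ.* S b ℚ.+ e ℚ.* S a) ℚ.- e ℚ.* S a
          ≤⟨ ℚ.+-monoˡ-≤ (ℚ.- (e ℚ.* S a)) (ℚ.+-monoʳ-≤ (Z a ℚ.* S b) (ℚ.+-mono-≤ (e*S≤½ b) (e*S≤½ a))) ⟩
        Z a ℚ.* S b ℚ.+ 1ℚ ℚ.- e ℚ.* S a
          ≡⟨ cong (λ p → p ℚ.- e ℚ.* S a) (trans (ℚ.+-comm (Z a ℚ.* S b) 1ℚ)
               (trans (cong (1ℚ ℚ.+_) (sym (/1-* (z a) (+ s b)))) (sym (/1-+ (+ 1) (z a ℤ.* + s b))))) ⟩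
        (+ 1 ℤ.+ z a ℤ.* + s b) / 1 ℚ.- e ℚ.* S a
          ≤⟨ ℚ.+-monoˡ-≤ (ℚ.- (e ℚ.* S a)) (/1-mono-≤ (ℤ.i<j⇒suc[i]≤j (step i))) ⟩
        (z b ℤ.* + s a) / 1 ℚ.- e ℚ.* S a
          ≡⟨ cong (λ p → p ℚ.- e ℚ.* S a) (/1-* (z b) (+ s a)) ⟩
        Z b ℚ.* S a ℚ.- e ℚ.* S a
          ≡⟨ solve 3 (λ z e a → z :* a :- e :* a := (z :- e) :* a) refl (Z b) e (S a) ⟩
        (Z b ℚ.- e) ℚ.* S a ∎
        where
        a b : Fin (suc n)
        a = inject₁ i
        b = suc i
      zₗ+e≤S : Z (fromℕ n) ℚ.+ e ℚ.≤ S (fromℕ n)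
      zₗ+e≤S = begin
        Z (fromℕ n) ℚ.+ e               ≤⟨ ℚ.+-monoʳ-≤ (Z (fromℕ n)) e≤1 ⟩
        Z (fromℕ n) ℚ.+ 1ℚ              ≡⟨ ℚ.+-comm (Z (fromℕ n)) 1ℚ ⟩
        1ℚ ℚ.+ Z (fromℕ n)              ≡⟨ /1-+ (+ 1) (z (fromℕ n)) ⟨
        (+ 1 ℤ.+ z (fromℕ n)) / 1       ≤⟨ /1-mono-≤ (ℤ.i<j⇒suc[i]≤j last) ⟩
        S (fromℕ n) ∎

    -- Shifting all coordinates by the same η > 0 stays in P, and makes the middle
    -- inequalities strict because s increases.
    interior⇒StrictlyInside : ∀ {z} → lattice z ∈ interior (lectureHallPolytope s) → StrictlyInside s z
    interior⇒StrictlyInside {z} (ε , (δ , 0<δ , N , δ≤ε) , nbhd) = strict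
      (/1-cancel-< (ℚ.<-≤-trans 0<η (0≤q-p⇒p≤q 0≤z₀-η)))
      (λ i → /1-cancel-< (subst₂ ℚ._<_ (sym (/1-* (z (inject₁ i)) (+ s (suc i)))) (sym (/1-* (z (suc i)) (+ s (inject₁ i))))
        (separated i)))
      (/1-cancel-< (ℚ.<-≤-trans
        (subst (ℚ._< Z (fromℕ n) ℚ.+ η) (ℚ.+-identityʳ (Z (fromℕ n))) (ℚ.+-monoʳ-< (Z (fromℕ n)) 0<η)) zₗ+η≤S))
      where
      open ℚ.≤-Reasoning
      Z : Fin (suc n) → ℚ
      Z i = z i / 1
      -- Half of the lower bound `δ` for the radius: one half is the shift, the other is the gap
      -- that `_<ℝ_` demands.
      η : ℚ
      η = ½ ℚ.* δ
      0<η : 0ℚ ℚ.< η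
      0<η = 0<½*ε 0<δ
      -η≤η : ℚ.- η ℚ.≤ η
      -η≤η = ℚ.≤-trans (ℚ.neg-antimono-≤ (ℚ.<⇒≤ 0<η)) (ℚ.<⇒≤ 0<η)
      η+η≤ε : ∀ k → N ≤ k → η ℚ.+ η ℚ.≤ seq ε k
      η+η≤ε k N≤k = begin
        η ℚ.+ η         ≡⟨ ½*ε+½*ε δ ⟩
        δ               ≡⟨ ℚ.+-identityˡ δ ⟨
        0ℚ ℚ.+ δ        ≤⟨ δ≤ε k N≤k ⟩
        seq ε k         ∎
      shifted : ∀ h → ℚ.- η ℚ.≤ h → h ℚ.≤ η →
        (λ i → fromℚ (Z i ℚ.+ h)) ∈ lectureHallPolytope s
      shifted h -η≤h h≤η = nbhd (λ i → fromℚ (Z i ℚ.+ h)) λ i →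
        (η , 0<η , N , λ k N≤k → begin
          Z i ℚ.- seq ε k ℚ.+ η
            ≤⟨ ℚ.+-monoˡ-≤ η (ℚ.+-monoʳ-≤ (Z i) (ℚ.neg-antimono-≤ (η+η≤ε k N≤k))) ⟩
          Z i ℚ.- (η ℚ.+ η) ℚ.+ η
            ≡⟨ solve 2 (λ z h → z :- (h :+ h) :+ h := z :+ (:- h)) refl (Z i) η ⟩
          Z i ℚ.+ ℚ.- η
            ≤⟨ ℚ.+-monoʳ-≤ (Z i) -η≤h ⟩
          Z i ℚ.+ h ∎) ,
        (η , 0<η , N , λ k N≤k → begin
          Z i ℚ.+ h ℚ.+ η          ≡⟨ ℚ.+-assoc (Z i) h η ⟩
          Z i ℚ.+ (h ℚ.+ η)        ≤⟨ ℚ.+-monoʳ-≤ (Z i) (ℚ.+-monoˡ-≤ η h≤η) ⟩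
          Z i ℚ.+ (η ℚ.+ η)        ≤⟨ ℚ.+-monoʳ-≤ (Z i) (η+η≤ε k N≤k) ⟩
          Z i ℚ.+ seq ε k          ∎)
      lowered : (λ i → fromℚ (Z i ℚ.- η)) ∈ lectureHallPolytope s
      lowered = shifted (ℚ.- η) ℚ.≤-refl -η≤η
      raised : (λ i → fromℚ (Z i ℚ.+ η)) ∈ lectureHallPolytope s
      raised = shifted η -η≤η ℚ.≤-refl
      0≤z₀-η : 0ℚ ℚ.≤ Z zero ℚ.- η
      0≤z₀-η = ℚ.*-cancelʳ-≤-pos (r zero)
        (subst (ℚ._≤ (Z zero ℚ.- η) ℚ.* r zero) (sym (ℚ.*-zeroˡ (r zero)))
          (fromℚ-cancel-≤ {0ℚ} {(Z zero ℚ.- η) ℚ.* r zero} (proj₁ lowered)))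
      zₗ+η≤S : Z (fromℕ n) ℚ.+ η ℚ.≤ S (fromℕ n)
      zₗ+η≤S = ℚ.*-cancelʳ-≤-pos (r (fromℕ n))
        (subst ((Z (fromℕ n) ℚ.+ η) ℚ.* r (fromℕ n) ℚ.≤_) (sym (S*r≡1 (fromℕ n)))
          (fromℚ-cancel-≤ {(Z (fromℕ n) ℚ.+ η) ℚ.* r (fromℕ n)} {1ℚ} (proj₂ (proj₂ raised))))
      separated : ∀ i → Z (inject₁ i) ℚ.* S (suc i) ℚ.< Z (suc i) ℚ.* S (inject₁ i)
      separated i = begin-strict
        Z a ℚ.* S b
          ≡⟨ solve 3 (λ z h b → z :* b := (z :+ h) :* b :- h :* b) refl (Z a) η (S b) ⟩
        (Z a ℚ.+ η) ℚ.* S b ℚ.- η ℚ.* S b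
          ≤⟨ ℚ.+-monoˡ-≤ (ℚ.- (η ℚ.* S b)) (clear-denominators (Z a ℚ.+ η) (Z b ℚ.+ η) a b
               (fromℚ-cancel-≤ {(Z a ℚ.+ η) ℚ.* r a} {(Z b ℚ.+ η) ℚ.* r b} (proj₁ (proj₂ raised) i))) ⟩
        (Z b ℚ.+ η) ℚ.* S a ℚ.- η ℚ.* S b
          <⟨ ℚ.+-monoʳ-< ((Z b ℚ.+ η) ℚ.* S a) (ℚ.neg-antimono-<
               (ℚ.*-monoʳ-<-pos η {{ℚ.positive 0<η}} (/1-mono-< {+ s a} {+ s b} (ℤ.+<+ (s-ascends s s-mono i))))) ⟩
        (Z b ℚ.+ η) ℚ.* S a ℚ.- η ℚ.* S a
          ≡⟨ solve 3 (λ z h a → (z :+ h) :* a :- h :* a := z :* a) refl (Z b) η (S a) ⟩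
        Z b ℚ.* S a ∎
        where
        a b : Fin (suc n)
        a = inject₁ i
        b = suc i

    interior⇔StrictlyInside : ∀ z → lattice z ∈ interior (lectureHallPolytope s) ⇔ StrictlyInside s z
    interior⇔StrictlyInside z = mk⇔ interior⇒StrictlyInside StrictlyInside⇒interior

  -- The vertices of P are (0, …, 0, s_{j+1}, …, s_d) for 0 ≤ j ≤ d.
  vertex : Fin (suc (suc n)) → Vector ℤ (suc n)
  vertex j i = + (indicator j i * s i)

  vertex∈lectureHallPolytope : ∀ j → lattice (vertex j) ∈ lectureHallPolytope s
  vertex∈lectureHallPolytope j =
    ≤-ratio {0ℝ} {ratio zero} {0} {indicator j zero} (λ _ → refl) (ratio≡ zero) ℕ.z≤n ,
    (λ i → ≤-ratio {ratio (inject₁ i)} {ratio (suc i)} (ratio≡ (inject₁ i)) (ratio≡ (suc i)) (indicator-ascends j i)) ,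
    ≤-ratio {ratio (fromℕ n)} {1ℝ} {indicator j (fromℕ n)} {1} (ratio≡ (fromℕ n)) (λ _ → refl) (indicator≤1 j (fromℕ n))
    where
    ratio : Vector ℝ (suc n)
    ratio i = lattice (vertex j) i ÷ℕ s i
    ratio≡ : ∀ i k → seq (ratio i) k ≡ + indicator j i / 1
    ratio≡ i k = begin
      + (h * s i) / 1 ℚ.* (+ 1 / s i)               ≡⟨ cong (λ z → z / 1 ℚ.* (+ 1 / s i)) (ℤ.pos-* h (s i)) ⟩
      (+ h ℤ.* + s i) / 1 ℚ.* (+ 1 / s i)           ≡⟨ cong (ℚ._* (+ 1 / s i)) (/1-* (+ h) (+ s i)) ⟩
      + h / 1 ℚ.* (+ s i / 1) ℚ.* (+ 1 / s i)       ≡⟨ ℚ.*-assoc (+ h / 1) (+ s i / 1) (+ 1 / s i) ⟩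
      + h / 1 ℚ.* (+ s i / 1 ℚ.* (+ 1 / s i))       ≡⟨ cong (+ h / 1 ℚ.*_) (n*1/n≡1 (s i)) ⟩
      + h / 1 ℚ.* 1ℚ                                ≡⟨ ℚ.*-identityʳ (+ h / 1) ⟩
      + h / 1 ∎
      where
      open ≡-Reasoning
      h : ℕ
      h = indicator j i
    ≤-ratio : ∀ {x y a b} → (∀ k → seq x k ≡ + a / 1) → (∀ k → seq y k ≡ + b / 1) → a ≤ b → x ≤ℝ y
    ≤-ratio {x} {y} {a} {b} x≡a y≡b a≤b = eventually-≤⇒≤ℝ {x} {y} (0 , λ k _ →
      subst₂ ℚ._≤_ (sym (x≡a k)) (sym (y≡b k)) (/1-mono-≤ {+ a} {+ b} (ℤ.+≤+ a≤b)))

  -- Translates as full-dimensional lattice simplices.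

  module _ (t : Vector ℤ (suc n)) where

    shiftedVertex : Fin (suc (suc n)) → Vector ℤ (suc n)
    shiftedVertex j i = vertex j i ℤ.+ t i

    private
      T : Fin (suc n) → ℚ
      T i = t i / 1

    linComb-shiftedVertex : ∀ c i k → seq (linComb c (λ j → lattice (shiftedVertex j)) i) k ≡
      S i ℚ.* seq (prefix c i) k ℚ.+ seq (∑ c) k ℚ.* T i
    linComb-shiftedVertex c i k = ∑-indicator c (s i) (t i) i k

    -- The barycentric coordinates are the gaps between consecutive ratios on the way from 0 to 1.
    -- With them the combination of vertices equals `x + t` term by term, so the only limit involved
    -- is the given `y ≈ᵥ x + t`.
    translate⊆hull : ∀ {y} → y ∈ translate (lattice t) (lectureHallPolytope s) →
      y ∈ convexHull (λ j → lattice (shiftedVertex j))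
    translate⊆hull {y} (x , (first , step , last) , y≈x+t) =
      c , increments-nonneg 0ℝ u first step last ,
      ≗⇒≈ℝ {∑ c} {1ℝ} (∑-increments 0ℝ u) ,
      λ i → Null-cong (λ k → cong (λ q → seq (y i) k ℚ.- q) (sym (begin
          seq (linComb c (λ j → lattice (shiftedVertex j)) i) k
            ≡⟨ linComb-shiftedVertex c i k ⟩
          S i ℚ.* seq (prefix c i) k ℚ.+ seq (∑ c) k ℚ.* T i
            ≡⟨ cong₂ (λ p q → S i ℚ.* p ℚ.+ q ℚ.* T i) (prefix-increments 0ℝ u i k) (∑-increments 0ℝ u k) ⟩
          S i ℚ.* (seq (x i) k ℚ.* r i ℚ.- 0ℚ) ℚ.+ 1ℚ ℚ.* T i
            ≡⟨ solve 4 (λ S x r t → S :* (x :* r :- con 0ℚ) :+ con 1ℚ :* t := x :* (S :* r) :+ t) refl (S i) (seq (x i) k) (r i) (T i) ⟩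
          seq (x i) k ℚ.* (S i ℚ.* r i) ℚ.+ T i
            ≡⟨ cong (λ q → seq (x i) k ℚ.* q ℚ.+ T i) (n*1/n≡1 (s i)) ⟩
          seq (x i) k ℚ.* 1ℚ ℚ.+ T i
            ≡⟨ cong (ℚ._+ T i) (ℚ.*-identityʳ (seq (x i) k)) ⟩
          seq (x i) k ℚ.+ T i ∎))) (y≈x+t i)
      where
      open ≡-Reasoning
      u : Vector ℝ (suc n)
      u i = x i ÷ℕ s i
      c : Vector ℝ (suc (suc n))
      c = increments 0ℝ u

    -- ((y - t) / s) - prefix c = (1 / s) * ((y - linComb c v) + t * (∑ c - 1))
    hull⊆translate : ∀ {y} → y ∈ convexHull (λ j → lattice (shiftedVertex j)) →
      y ∈ translate (lattice t) (lectureHallPolytope s)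
    hull⊆translate {y} (c , 0≤c , ∑≈1 , y≈v) =
      x ,
      ( ≤ℝ-cong {0ℝ} {prefix c zero} {0ℝ} {u zero} (≈ℝ-refl {0ℝ}) (prefix≈u zero) (0≤c zero)
      , (λ i → ≤ℝ-cong {prefix c (inject₁ i)} {prefix c (suc i)} {u (inject₁ i)} {u (suc i)}
          (prefix≈u (inject₁ i)) (prefix≈u (suc i)) (prefix-ascends c 0≤c i))
      , ≤ℝ-cong {prefix c (fromℕ n)} {∑ c} {u (fromℕ n)} {1ℝ}
          (prefix≈u (fromℕ n)) ∑≈1 (prefix-last≤∑ c 0≤c)) ,
      λ i → ≗⇒≈ℝ {y i} {(y i -ℝ lattice t i) +ℝ lattice t i}
        (λ k → solve 2 (λ y t → y := (y :- t) :+ t) refl (seq (y i) k) (T i))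
      where
      open ≡-Reasoning
      x u : Vector ℝ (suc n)
      x i = y i -ℝ lattice t i
      u i = x i ÷ℕ s i
      prefix≈u : ∀ i → prefix c i ≈ℝ u i
      prefix≈u i = ≈ℝ-sym {u i} {prefix c i} (Null-cong
        (λ k → begin
          r i ℚ.* ((seq (y i) k ℚ.- seq (linComb c (λ j → lattice (shiftedVertex j)) i) k) ℚ.+ T i ℚ.* (seq (∑ c) k ℚ.- 1ℚ))
            ≡⟨ cong (λ q → r i ℚ.* ((seq (y i) k ℚ.- q) ℚ.+ T i ℚ.* (seq (∑ c) k ℚ.- 1ℚ))) (linComb-shiftedVertex c i k) ⟩
          r i ℚ.* ((seq (y i) k ℚ.- (S i ℚ.* seq (prefix c i) k ℚ.+ seq (∑ c) k ℚ.* T i)) ℚ.+ T i ℚ.* (seq (∑ c) k ℚ.- 1ℚ))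
            ≡⟨ solve 6 (λ r y S p σ t → r :* ((y :- (S :* p :+ σ :* t)) :+ t :* (σ :- con 1ℚ)) := (y :- t) :* r :- p :* (S :* r)) refl
                 (r i) (seq (y i) k) (S i) (seq (prefix c i) k) (seq (∑ c) k) (T i) ⟩
          (seq (y i) k ℚ.- T i) ℚ.* r i ℚ.- seq (prefix c i) k ℚ.* (S i ℚ.* r i)
            ≡⟨ cong (λ q → (seq (y i) k ℚ.- T i) ℚ.* r i ℚ.- q)
                 (trans (cong (seq (prefix c i) k ℚ.*_) (n*1/n≡1 (s i))) (ℚ.*-identityʳ (seq (prefix c i) k))) ⟩
          (seq (y i) k ℚ.- T i) ℚ.* r i ℚ.- seq (prefix c i) k ∎)
        (Null-* (r i) (Null-+ (y≈v i) (Null-* (T i) ∑≈1))))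

    translate-isLatticePolytope : IsLatticePolytope (translate (lattice t) (lectureHallPolytope s))
    translate-isLatticePolytope = suc (suc n) , shiftedVertex , (λ {y} → translate⊆hull {y}) , (λ {y} → hull⊆translate {y})

    -- `S i` times a partial sum is the combination minus `T i * ∑ c`, a difference of null
    -- sequences. Hence all partial sums vanish, and with them all entries.
    shiftedVertex-affinelyIndependent : AffinelyIndependent (λ j → lattice (shiftedVertex j))
    shiftedVertex-affinelyIndependent c ∑≈0 v≈0 = prefix≈0⇒≈0 c prefix≈0 ∑≈0
      where
      open ≡-Reasoning
      prefix≈0 : prefix c ≈ᵥ 0ᵥ
      prefix≈0 i = Null-cong
        (λ k → begin
          r i ℚ.* ((seq (linComb c (λ j → lattice (shiftedVertex j)) i) k ℚ.- 0ℚ) ℚ.- T i ℚ.* (seq (∑ c) k ℚ.- 0ℚ))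
            ≡⟨ cong (λ q → r i ℚ.* ((q ℚ.- 0ℚ) ℚ.- T i ℚ.* (seq (∑ c) k ℚ.- 0ℚ))) (linComb-shiftedVertex c i k) ⟩
          r i ℚ.* ((S i ℚ.* seq (prefix c i) k ℚ.+ seq (∑ c) k ℚ.* T i ℚ.- 0ℚ) ℚ.- T i ℚ.* (seq (∑ c) k ℚ.- 0ℚ))
            ≡⟨ solve 5 (λ r S p σ t → r :* ((S :* p :+ σ :* t :- con 0ℚ) :- t :* (σ :- con 0ℚ)) := p :* (S :* r) :- con 0ℚ) refl
                 (r i) (S i) (seq (prefix c i) k) (seq (∑ c) k) (T i) ⟩
          seq (prefix c i) k ℚ.* (S i ℚ.* r i) ℚ.- 0ℚ
            ≡⟨ cong (λ q → q ℚ.- 0ℚ)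
                 (trans (cong (seq (prefix c i) k ℚ.*_) (n*1/n≡1 (s i))) (ℚ.*-identityʳ (seq (prefix c i) k))) ⟩
          seq (prefix c i) k ℚ.- 0ℚ ∎)
        (Null-* (r i) (Null-- (v≈0 i) (Null-* (T i) ∑≈0)))

    translate-isFullDimensional : IsFullDimensional (translate (lattice t) (lectureHallPolytope s))
    translate-isFullDimensional =
      (λ j → lattice (shiftedVertex j)) ,
      (λ j → lattice (vertex j) , vertex∈lectureHallPolytope j , λ i →
        ≗⇒≈ℝ {lattice (shiftedVertex j) i} {lattice (vertex j) i +ℝ lattice t i} (λ _ → /1-+ (vertex j i) (t i))) ,
      shiftedVertex-affinelyIndependent

  -- Moving the interior lattice point to the origin.

  fano-translate⇒unique : ((Q , _ , t , _) : TranslationEquivalentToFano (lectureHallPolytope s)) →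
    UniqueInteriorLatticePoint (lectureHallPolytope s) (λ i → ℤ.- t i)
  fano-translate⇒unique (Q , fano , t , Q≐P+t) z = mk⇔
    (λ z∈int i → inverseˡ-unique (z i) (t i) (to (interiorPoints (λ i → z i ℤ.+ t i)) (to (equivalent (λ i → z i ℤ.+ t i) λ _ → refl) z∈int) i))
    (λ z≗-t → from (equivalent (λ _ → + 0) λ i → sym (trans (cong (ℤ._+ t i) (z≗-t i)) (ℤ.+-inverseˡ (t i))))
      (from (interiorPoints (λ _ → + 0)) λ _ → refl))
    where
    open IsFano fano
    equivalent : ∀ z′ → (∀ i → z′ i ≡ z i ℤ.+ t i) →
      lattice z ∈ interior (lectureHallPolytope s) ⇔ lattice z′ ∈ interior Q
    equivalent z′ = interior-translate (lectureHallPolytope-resp s) t Q≐P+t z z′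

  unique⇒fano-translate : ∀ {w} → UniqueInteriorLatticePoint (lectureHallPolytope s) w →
    TranslationEquivalentToFano (lectureHallPolytope s)
  unique⇒fano-translate {w} unique = Q , fano , t , ((λ q → q) , (λ q → q))
    where
    t : Vector ℤ (suc n)
    t i = ℤ.- w i
    Q : Subset (suc n)
    Q = translate (lattice t) (lectureHallPolytope s)
    equivalent : ∀ z → lattice (λ i → z i ℤ.+ w i) ∈ interior (lectureHallPolytope s) ⇔ lattice z ∈ interior Q
    equivalent z = interior-translate (lectureHallPolytope-resp s) t ((λ q → q) , (λ q → q)) (λ i → z i ℤ.+ w i) z
      (λ i → sym (//-rightDividesʳ (w i) (z i)))
    fano : IsFano Q
    fano = record
      { latticePolytope = translate-isLatticePolytope t
      ; fullDimensional = translate-isFullDimensional t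
      ; interiorPoints  = λ z → mk⇔
          (λ z∈int i → trans (sym (//-rightDividesʳ (w i) (z i)))
            (trans (cong (λ a → a ℤ.- w i) (to (unique (λ i → z i ℤ.+ w i)) (from (equivalent z) z∈int) i)) (ℤ.+-inverseʳ (w i))))
          (λ z≗0 → to (equivalent z) (from (unique (λ i → z i ℤ.+ w i)) λ i →
            trans (cong (ℤ._+ w i) (z≗0 i)) (ℤ.+-identityˡ (w i))))
      }

theorem2p2 : (n : ℕ) (s : Vector ℕ (suc n)) .{{_ : ∀ {i} → NonZero (s i)}} →
    s Preserves Fin._<_ ⟶ _<_ →
    (TranslationEquivalentToFano (lectureHallPolytope s) ⇔
    (s zero ≡ 2 × (∀ (i : Fin n) → s (suc i) ≤ 2 * s (inject₁ i)))) ×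
    (TranslationEquivalentToFano (lectureHallPolytope s) →
    UniqueInteriorLatticePoint (lectureHallPolytope s) (λ i → + s i ℤ.- + 1))
theorem2p2 n s s-mono = mk⇔ necessary (λ cond → unique⇒fano-translate s (ones-uniqueInterior cond)) ,
  -- The interior point is found by way of the numerical condition on `s`.
  λ fano → ones-uniqueInterior (necessary fano)
  where
  interior⇔ : ∀ z → lattice z ∈ interior (lectureHallPolytope s) ⇔ StrictlyInside s z
  interior⇔ = interior⇔StrictlyInside s s-mono

  -- The point left as an underscore below is the negated translation vector, in the role of `u`.
  necessary : TranslationEquivalentToFano (lectureHallPolytope s) →
    s zero ≡ 2 × (∀ i → s (suc i) ≤ 2 * s (inject₁ i))
  necessary fano = unique⇒s₀≡2 s s-mono inside unique , unique⇒≤2* s s-mono inside unique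
    where
    uniqueInterior : UniqueInteriorLatticePoint (lectureHallPolytope s) _
    uniqueInterior = fano-translate⇒unique s fano
    inside : StrictlyInside s _
    inside = to (interior⇔ _) (from (uniqueInterior _) λ _ → refl)
    unique : ∀ z → StrictlyInside s z → z ≗ _
    unique z z-inside = to (uniqueInterior z) (from (interior⇔ z) z-inside)

  ones-uniqueInterior : s zero ≡ 2 × (∀ i → s (suc i) ≤ 2 * s (inject₁ i)) →
    UniqueInteriorLatticePoint (lectureHallPolytope s) (λ i → + s i ℤ.- + 1)
  ones-uniqueInterior (s₀≡2 , s≤2s) z = mk⇔
    (λ z∈int → ones-unique s s-mono s₀≡2 s≤2s (to (interior⇔ z) z∈int))
    (λ z≗s-1 → from (interior⇔ z) (StrictlyInside-cong s (λ i → sym (z≗s-1 i))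
      (ones-StrictlyInside s s-mono (ℕ.≤-reflexive (sym s₀≡2)))))
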